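{- Let $d\ge 5$ be odd and $D\ge 4$. If $n=d\left(1+(d-1)+\dots+(d-1)^{D-1}\right)-1\not\equiv 0 \pmod D$, then there is no $(d,D,-2)$-graph (of order $n$).
   Context: All graphs are simple. For integers $\Delta\ge 2$, $D\ge 1$, the Moore bound is $M(\Delta,D)=1+\Delta\left(1+(\Delta-1)+\dots+(\Delta-1)^{D-1}\right)$. For $\epsilon\ge 0$, a $(\Delta,D,-\epsilon)$-graph is a graph of maximum degree $\Delta$, diameter $D$, and order exactly $M(\Delta,D)-\epsilon$. Note that $M(d,D)-2=d\left(1+(d-1)+\dots+(d-1)^{D-1}\right)-1$. -}

module Defs where

open import Data.Nat using (ℕ; zero; suc; _+_; _*_; _∸_; _^_; _≤_; _<_)
open import Data.Fin using (Fin)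
open import Data.Bool using (Bool; true; false)
open import Data.List using (List; length; filter)
open import Data.List using () renaming (allFin to allFinL)
open import Data.Product using (Σ; ∃; ∃-syntax; _×_; _,_)
open import Data.Empty using (⊥)
open import Relation.Binary.PropositionalEquality using (_≡_)
open import Relation.Nullary using (¬_)
open import Data.Bool using (T)
open import Relation.Nullary.Decidable using (Dec)
open import Data.Bool.Properties using (T?)

record Graph (n : ℕ) : Set where
  field
    adj     : Fin n → Fin n → Bool
    sym     : ∀ u v → adj u v ≡ adj v u
    irrefl  : ∀ v → adj v v ≡ false

open Graph public

degree : ∀ {n} → Graph n → Fin n → ℕ
degree G v = length (filter (λ u → T? (adj G v u)) (allFinL _))

MaxDegree : ∀ {n} → Graph n → ℕ → Set
MaxDegree G Δ = (∀ v → degree G v ≤ Δ) × (∃[ v ] degree G v ≡ Δ)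

data Walk {n : ℕ} (G : Graph n) : Fin n → Fin n → ℕ → Set where
  here : ∀ {u} → Walk G u u zero
  step : ∀ {u w v k} → T (adj G u w) → Walk G w v k → Walk G u v (suc k)

DistLe : ∀ {n} → Graph n → Fin n → Fin n → ℕ → Set
DistLe G u v k = ∃[ j ] (j ≤ k × Walk G u v j)

Diameter : ∀ {n} → Graph n → ℕ → Set
Diameter G D =
  (∀ u v → DistLe G u v D) ×
  (∃[ u ] ∃[ v ] ((∀ j → j < D → ¬ Walk G u v j)))

geomSum : ℕ → ℕ → ℕ
geomSum q zero = 0
geomSum q (suc D) = q ^ D + geomSum q D

moore : ℕ → ℕ → ℕ
moore Δ D = 1 + Δ * geomSum (Δ ∸ 1) D

IsDDEGraph : ∀ {n} → ℕ → ℕ → ℕ → Graph n → Set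
IsDDEGraph {n} Δ D ε G = MaxDegree G Δ × Diameter G D × (n ≡ moore Δ D ∸ ε)

{-# OPTIONS --safe #-}

-- Write d = q + 1 and let B u t be the number of nonbacktracking walks of length
-- at most D from u to t, minus one.  The order forces regularity and row sums 2
-- of B, and B commutes with the adjacency matrix, hence with the matrices F k
-- that count the nonbacktracking walks of length k.  As q ≥ 4, no two vertices
-- are joined by two walks shorter than D, so 1 ≤ B u t means that u and t are
-- opposite on a cycle of length 2D − 1 or 2D.
--
-- All repeats of the vertices of a cycle of length 2D − 1, or of three walks of
-- length D with common ends, are in this subgraph H.  Following the repeats of
-- a neighbour of H, by commutation of B with F 2 and F (D − 1), produces a closed
-- walk of length 2D that uses H only partly, which is impossible.  Thus
-- B u t ≤ 1, and u, t determine a cycle of length 2D if B u t = 1.  The 2n pairs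
-- of repeats are therefore partitioned into the sets of 2D opposite pairs on
-- these cycles, so that D divides n.

module Submission where

open import Defs
open import Data.Nat
open import Data.Nat.Properties
open import Data.Nat.DivMod using (_/_; _%_; m≡m%n+[m/n]*n; m%n<n)
open import Data.Nat.Divisibility using (_∣_; ∣m∣n⇒∣m+n; ∣-refl; _∣0; *-cancelʳ-∣)
open import Data.Bool using (Bool; true; false; T; if_then_else_)
open import Data.Bool.Properties using (T?)
open import Data.Fin using (Fin; zero; suc) renaming (_≟_ to _≟F_)
open import Data.List using (List; []; _∷_; length; filter; map; _++_; tabulate; allFin; applyUpTo; cartesianProduct)
open import Data.List.Properties using (filter-++; length-++; length-applyUpTo; length-tabulate)
open import Data.List.Membership.Propositional using (_∈_)
open import Data.List.Membership.Propositional.Properties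
  using (∈-filter⁺; ∈-filter⁻; ∈-cartesianProduct⁺; ∈-applyUpTo⁺; ∈-applyUpTo⁻; ∈-allFin)
open import Data.List.Membership.Propositional.Properties.WithK using (unique∧set⇒bag)
import Data.List.Membership.DecPropositional as DecMembership
open import Data.List.Relation.Binary.BagAndSetEquality using (∼bag⇒↭)
open import Data.List.Relation.Binary.Permutation.Propositional.Properties using (↭-length)
open import Data.List.Relation.Unary.Any using (here)
open import Data.List.Relation.Unary.Unique.Propositional using (Unique)
open import Data.List.Relation.Unary.Unique.Propositional.Properties
  using (filter⁺; allFin⁺; cartesianProduct⁺; applyUpTo⁺₁)
open import Data.Product using (∃; ∃-syntax; _×_; _,_; proj₁; proj₂)
open import Data.Product.Properties using (≡-dec)
open import Data.Sum using (_⊎_; inj₁; inj₂)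
open import Data.Empty using (⊥; ⊥-elim)
open import Data.Unit using (tt)
open import Function using (_∘_; id; mk⇔)
open import Relation.Nullary using (Dec; ¬_; yes; no; does; contradiction)
open import Relation.Nullary.Decidable using (dec-true; dec-false; ¬?)
open import Relation.Unary using (Decidable)
open import Relation.Binary using (DecidableEquality; tri<; tri≈; tri>)
open import Relation.Binary.PropositionalEquality hiding (J) renaming (sym to ≡sym)
open import Algebra.Properties.Semiring.Sum +-*-semiring
  using (sum-cong-≗; ∑-distrib-+; ∑-comm; *-distribˡ-sum; *-distribʳ-sum; sum-replicate-zero)
  renaming (sum to ∑)

-- Finite sums and matrices

-- A vertex has two repeats, counted with multiplicity, so no map sends a vertex to its repeat; the
-- matrix `B` takes its place. That `B` commutes with `F (suc k)` gives: if a nonbacktracking walk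
-- of length k + 1 leads from c to y, then for every repeat of y some repeat of c is joined to it by
-- such a walk. Which of the two repeats of c this is remains open, so the main argument excludes
-- the one already known, and several walks must then end at the other one. The final count needs
-- classes of equal size. Cycles of length 2D - 1 and entries 2 of `B` would spoil it, and one
-- argument, `impossible`, removes both. It needs a set H that no walk of length at most D between a
-- vertex of H and a repeat of it leaves, four consecutive repeats in H, and a neighbour of one of
-- them outside H. That neighbour exists because the degree exceeds 2.

*-positive : ∀ {x y} → 1 ≤ x * y → 1 ≤ x × 1 ≤ y
*-positive {suc x} {suc y} _ = s≤s z≤n , s≤s z≤n
*-positive {suc x} {zero}  p rewrite *-zeroʳ x = contradiction p (λ ())

≤⇒∃+ : ∀ {m n} → m ≤ n → ∃[ o ] o + m ≡ n
≤⇒∃+ {m} {n} m≤n = n ∸ m , m∸n+n≡m m≤n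

∑-mono : ∀ {n} {f g : Fin n → ℕ} → (∀ i → f i ≤ g i) → ∑ f ≤ ∑ g
∑-mono {zero}  f≤g = z≤n
∑-mono {suc n} f≤g = +-mono-≤ (f≤g zero) (∑-mono (f≤g ∘ suc))

∑-const : ∀ {n} c → ∑ {n} (λ _ → c) ≡ n * c
∑-const {zero}  c = refl
∑-const {suc n} c = cong (c +_) (∑-const {n} c)

∑-zero : ∀ {n} → ∑ {n} (λ _ → 0) ≡ 0
∑-zero {n} = sum-replicate-zero n

term≤∑ : ∀ {n} (f : Fin n → ℕ) i → f i ≤ ∑ f
term≤∑ f zero    = m≤m+n _ _
term≤∑ f (suc i) = ≤-trans (term≤∑ (f ∘ suc) i) (m≤n+m _ _)

∑-positive : ∀ {n} (f : Fin n → ℕ) → 1 ≤ ∑ f → ∃[ i ] 1 ≤ f i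
∑-positive {suc n} f p with f zero in eq
... | suc _ = zero , subst (1 ≤_) (≡sym eq) (s≤s z≤n)
... | zero  with ∑-positive (f ∘ suc) p
...   | i , q = suc i , q

mask : ∀ {n} → Fin n → (Fin n → ℕ) → Fin n → ℕ
mask i f j = if does (i ≟F j) then 0 else f j

δ : ∀ {n} → Fin n → Fin n → ℕ
δ i j = if does (i ≟F j) then 1 else 0

δ-diag : ∀ {n} (i : Fin n) → δ i i ≡ 1
δ-diag i rewrite dec-true (i ≟F i) refl = refl

δ-off : ∀ {n} {i j : Fin n} → i ≢ j → δ i j ≡ 0
δ-off {i = i} {j} i≢j rewrite dec-false (i ≟F j) i≢j = refl

δ-sym : ∀ {n} (i j : Fin n) → δ i j ≡ δ j i
δ-sym i j with i ≟F j
... | yes refl = ≡sym (δ-diag i)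
... | no i≢j   = ≡sym (δ-off (i≢j ∘ ≡sym))

mask-off : ∀ {n} {i j : Fin n} f → i ≢ j → mask i f j ≡ f j
mask-off {i = i} {j} f i≢j rewrite dec-false (i ≟F j) i≢j = refl

mask-positive : ∀ {n} {i j : Fin n} f → 1 ≤ mask i f j → i ≢ j × 1 ≤ f j
mask-positive {i = i} {j} f p with i ≟F j
... | no i≢j = i≢j , p

∑-split : ∀ {n} (f : Fin n → ℕ) i → ∑ f ≡ f i + ∑ (mask i f)
∑-split f zero    = refl
∑-split f (suc i) = trans (cong (f zero +_) (∑-split (f ∘ suc) i))
  (trans (≡sym (+-assoc (f zero) (f (suc i)) _))
  (trans (cong (_+ ∑ (mask i (f ∘ suc))) (+-comm (f zero) (f (suc i)))) (+-assoc (f (suc i)) (f zero) _)))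

two≤∑ : ∀ {n} (f : Fin n → ℕ) {i j} → i ≢ j → f i + f j ≤ ∑ f
two≤∑ f {i} {j} i≢j = begin
  f i + f j          ≡⟨ cong (f i +_) (mask-off f i≢j) ⟨
  f i + mask i f j   ≤⟨ +-monoʳ-≤ (f i) (term≤∑ (mask i f) j) ⟩
  f i + ∑ (mask i f) ≡⟨ ∑-split f i ⟨
  ∑ f                ∎
  where open ≤-Reasoning

three≤∑ : ∀ {n} (f : Fin n → ℕ) {i j k} → i ≢ j → i ≢ k → j ≢ k → f i + (f j + f k) ≤ ∑ f
three≤∑ f {i} {j} {k} i≢j i≢k j≢k = begin
  f i + (f j + f k)               ≡⟨ cong₂ (λ x y → f i + (x + y)) (mask-off f i≢j) (mask-off f i≢k) ⟨
  f i + (mask i f j + mask i f k) ≤⟨ +-monoʳ-≤ (f i) (two≤∑ (mask i f) j≢k) ⟩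
  f i + ∑ (mask i f)              ≡⟨ ∑-split f i ⟨
  ∑ f                             ∎
  where open ≤-Reasoning

four≤∑ : ∀ {n} (f : Fin n → ℕ) {i j k l} → i ≢ j → i ≢ k → i ≢ l → j ≢ k → j ≢ l → k ≢ l →
  f i + (f j + (f k + f l)) ≤ ∑ f
four≤∑ f {i} {j} {k} {l} i≢j i≢k i≢l j≢k j≢l k≢l = begin
  f i + (f j + (f k + f l))
    ≡⟨ cong₂ (λ x y → f i + (x + y)) (mask-off f i≢j) (cong₂ _+_ (mask-off f i≢k) (mask-off f i≢l)) ⟨
  f i + (mask i f j + (mask i f k + mask i f l))
    ≤⟨ +-monoʳ-≤ (f i) (three≤∑ (mask i f) j≢k j≢l k≢l) ⟩
  f i + ∑ (mask i f)
    ≡⟨ ∑-split f i ⟨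
  ∑ f ∎
  where open ≤-Reasoning

another-term : ∀ {n} (f : Fin n → ℕ) i → f i < ∑ f → ∃[ j ] i ≢ j × 1 ≤ f j
another-term f i fi<∑ with ∑-positive (mask i f)
    (+-cancelˡ-≤ (f i) 1 _ (subst (f i + 1 ≤_) (∑-split f i) (subst (_≤ ∑ f) (+-comm 1 (f i)) fi<∑)))
... | j , p = j , mask-positive f p

third-term : ∀ {n} (f : Fin n → ℕ) i j → f i + f j < ∑ f → ∃[ k ] i ≢ k × j ≢ k × 1 ≤ f k
third-term f i j lt with another-term (mask i f) j
    (≤-trans (s≤s (mask≤ j)) (+-cancelˡ-≤ (f i) _ _ (subst₂ _≤_ (≡sym (+-suc (f i) (f j))) (∑-split f i) lt)))
  where
  mask≤ : ∀ j → mask i f j ≤ f j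
  mask≤ j with i ≟F j
  ... | yes _ = z≤n
  ... | no _  = ≤-refl
... | k , j≢k , p with mask-positive f p
... | i≢k , q = k , i≢k , j≢k , q

∑-δˡ : ∀ {n} (i : Fin n) (f : Fin n → ℕ) → ∑ (λ j → δ i j * f j) ≡ f i
∑-δˡ {n} i f = begin
  ∑ g                ≡⟨ ∑-split g i ⟩
  g i + ∑ (mask i g) ≡⟨ cong₂ _+_ (trans (cong (_* f i) (δ-diag i)) (+-identityʳ _)) (trans (sum-cong-≗ vanish) (∑-zero {n})) ⟩
  f i + 0            ≡⟨ +-identityʳ _ ⟩
  f i                ∎
  where
  open ≡-Reasoning
  g = λ j → δ i j * f j
  vanish : ∀ j → mask i g j ≡ 0
  vanish j with i ≟F j
  ... | yes _   = refl
  ... | no _ = refl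

∑-δʳ : ∀ {n} (i : Fin n) (f : Fin n → ℕ) → ∑ (λ j → f j * δ j i) ≡ f i
∑-δʳ i f = trans (sum-cong-≗ (λ j → trans (*-comm (f j) _) (cong (_* f j) (δ-sym j i)))) (∑-δˡ i f)

∑-δ : ∀ {n} (i : Fin n) → ∑ (δ i) ≡ 1
∑-δ i = trans (sum-cong-≗ (λ j → ≡sym (*-identityʳ (δ i j)))) (∑-δˡ i (λ _ → 1))

Matrix : ℕ → Set
Matrix n = Fin n → Fin n → ℕ

infixl 7 _∙_
infix  4 _≋_

_∙_ : ∀ {n} → Matrix n → Matrix n → Matrix n
(M ∙ N) u v = ∑ λ w → M u w * N w v

_≋_ : ∀ {n} → Matrix n → Matrix n → Set
M ≋ N = ∀ u v → M u v ≡ N u v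

∙-assoc : ∀ {n} (L M N : Matrix n) → (L ∙ M) ∙ N ≋ L ∙ (M ∙ N)
∙-assoc L M N u v = begin
  ∑ (λ w → ∑ (λ x → L u x * M x w) * N w v)    ≡⟨ sum-cong-≗ (λ w → *-distribʳ-sum (N w v) (λ x → L u x * M x w)) ⟩
  ∑ (λ w → ∑ (λ x → L u x * M x w * N w v))    ≡⟨ ∑-comm (λ w x → L u x * M x w * N w v) ⟩
  ∑ (λ x → ∑ (λ w → L u x * M x w * N w v))    ≡⟨ sum-cong-≗ (λ x → sum-cong-≗ (λ w → *-assoc (L u x) (M x w) (N w v))) ⟩
  ∑ (λ x → ∑ (λ w → L u x * (M x w * N w v)))  ≡⟨ sum-cong-≗ (λ x → *-distribˡ-sum (L u x) (λ w → M x w * N w v)) ⟨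
  ∑ (λ x → L u x * ∑ (λ w → M x w * N w v))    ∎
  where open ≡-Reasoning

∙-congˡ : ∀ {n} {M M′ : Matrix n} (N : Matrix n) → M ≋ M′ → N ∙ M ≋ N ∙ M′
∙-congˡ N eq u v = sum-cong-≗ λ w → cong (N u w *_) (eq w v)

∙-congʳ : ∀ {n} {M M′ : Matrix n} (N : Matrix n) → M ≋ M′ → M ∙ N ≋ M′ ∙ N
∙-congʳ N eq u v = sum-cong-≗ λ w → cong (_* N w v) (eq u w)

infixl 6 _⊞_
_⊞_ : ∀ {n} → Matrix n → Matrix n → Matrix n
(M ⊞ N) u v = M u v + N u v

infixr 8 _⊡_
_⊡_ : ∀ {n} → ℕ → Matrix n → Matrix n
(c ⊡ M) u v = c * M u v

∙-distribˡ-⊞ : ∀ {n} (L M N : Matrix n) → L ∙ (M ⊞ N) ≋ (L ∙ M) ⊞ (L ∙ N)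
∙-distribˡ-⊞ L M N u v = trans (sum-cong-≗ (λ w → *-distribˡ-+ (L u w) (M w v) (N w v)))
  (∑-distrib-+ (λ w → L u w * M w v) (λ w → L u w * N w v))

∙-distribʳ-⊞ : ∀ {n} (L M N : Matrix n) → (M ⊞ N) ∙ L ≋ (M ∙ L) ⊞ (N ∙ L)
∙-distribʳ-⊞ L M N u v = trans (sum-cong-≗ (λ w → *-distribʳ-+ (L w v) (M u w) (N u w)))
  (∑-distrib-+ (λ w → M u w * L w v) (λ w → N u w * L w v))

∙-⊡ˡ : ∀ {n} c (M N : Matrix n) → (c ⊡ M) ∙ N ≋ c ⊡ (M ∙ N)
∙-⊡ˡ c M N u v = trans (sum-cong-≗ (λ w → *-assoc c (M u w) (N w v))) (≡sym (*-distribˡ-sum c (λ w → M u w * N w v)))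

∙-⊡ʳ : ∀ {n} c (M N : Matrix n) → M ∙ (c ⊡ N) ≋ c ⊡ (M ∙ N)
∙-⊡ʳ c M N u v = trans (sum-cong-≗ (λ w → begin
    M u w * (c * N w v) ≡⟨ *-assoc (M u w) c _ ⟨
    M u w * c * N w v   ≡⟨ cong (_* N w v) (*-comm (M u w) c) ⟩
    c * M u w * N w v   ≡⟨ *-assoc c (M u w) _ ⟩
    c * (M u w * N w v) ∎)) (≡sym (*-distribˡ-sum c (λ w → M u w * N w v)))
  where open ≡-Reasoning

-- Counting in lists

length-filter-¬ : ∀ {A : Set} {Q : A → Set} (Q? : Decidable Q) xs →
  length xs ≡ length (filter Q? xs) + length (filter (¬? ∘ Q?) xs)
length-filter-¬ Q? [] = refl
length-filter-¬ Q? (x ∷ xs) with Q? x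
... | yes _ = cong suc (length-filter-¬ Q? xs)
... | no _  = trans (cong suc (length-filter-¬ Q? xs)) (≡sym (+-suc (length (filter Q? xs)) _))

length-filter-map : ∀ {A A′ : Set} {Q : A′ → Set} (Q? : Decidable Q) (f : A → A′) xs →
  length (filter Q? (map f xs)) ≡ length (filter (Q? ∘ f) xs)
length-filter-map Q? f [] = refl
length-filter-map Q? f (x ∷ xs) with Q? (f x)
... | yes _ = cong suc (length-filter-map Q? f xs)
... | no _  = length-filter-map Q? f xs

length-filter-product : ∀ {A A′ : Set} {Q : A × A′ → Set} (Q? : Decidable Q) xs ys k →
  (∀ x → length (filter (Q? ∘ (x ,_)) ys) ≡ k) → length (filter Q? (cartesianProduct xs ys)) ≡ length xs * k
length-filter-product Q? [] ys k eq = refl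
length-filter-product Q? (x ∷ xs) ys k eq = begin
  length (filter Q? (map (x ,_) ys ++ cartesianProduct xs ys))
    ≡⟨ cong length (filter-++ Q? (map (x ,_) ys) _) ⟩
  length (filter Q? (map (x ,_) ys) ++ filter Q? (cartesianProduct xs ys))
    ≡⟨ length-++ (filter Q? (map (x ,_) ys)) ⟩
  length (filter Q? (map (x ,_) ys)) + length (filter Q? (cartesianProduct xs ys))
    ≡⟨ cong₂ _+_ (trans (length-filter-map Q? (x ,_) ys) (eq x)) (length-filter-product Q? xs ys k eq) ⟩
  k + length xs * k ∎
  where open ≡-Reasoning

length-filter-∑ : ∀ {n} {A : Set} (f : A → ℕ) (g : Fin n → A) → (∀ i → f (g i) ≤ 1) →
  length (filter (λ x → 1 ≤? f x) (tabulate g)) ≡ ∑ (λ i → f (g i))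
length-filter-∑ {zero}  f g f≤1 = refl
length-filter-∑ {suc n} f g f≤1 with f (g zero) | f≤1 zero
... | zero  | _ = length-filter-∑ f (g ∘ suc) (f≤1 ∘ suc)
... | suc _ | s≤s z≤n = cong suc (length-filter-∑ f (g ∘ suc) (f≤1 ∘ suc))

module _ {A : Set} (_≟_ : DecidableEquality A) where

  open DecMembership _≟_ using (_∈?_)

  length-common : ∀ {xs ys : List A} → Unique xs → Unique ys → (∀ {x} → x ∈ ys → x ∈ xs) →
    length (filter (_∈? ys) xs) ≡ length ys
  length-common {xs} {ys} xs! ys! ys⊆xs = ↭-length (∼bag⇒↭ (unique∧set⇒bag (filter⁺ (_∈? ys) xs!) ys!
    (mk⇔ (λ x∈ → proj₂ (∈-filter⁻ (_∈? ys) {xs = xs} x∈)) (λ x∈ → ∈-filter⁺ (_∈? ys) (ys⊆xs x∈) x∈))))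

  -- Induction on the bound `k`: the class of the first element is removed, and by the fourth
  -- hypothesis the class of any remaining element is disjoint from it, hence survives whole.
  -- `Class` is a relation because one element may be given several lists.
  partition⇒∣ : ∀ m (Class : A → List A → Set) →
    (∀ {x c} → Class x c → length c ≡ m × Unique c × x ∈ c) →
    (∀ {x c z c′ w} → Class x c → Class z c′ → w ∈ c → w ∈ c′ → z ∈ c) →
    ∀ k xs → length xs ≤ k → Unique xs →
    (∀ {x} → x ∈ xs → ∃[ c ] Class x c × (∀ {w} → w ∈ c → w ∈ xs)) → m ∣ length xs
  partition⇒∣ m Class props meet k       []       _  _  _ = m ∣0
  partition⇒∣ m Class props meet (suc k) (x ∷ xs) l≤ u classOf with classOf (here refl)
  ... | c , Cx , c⊆ with props Cx
  ... | |c|≡m , c! , x∈c = subst (m ∣_) (≡sym total) (∣m∣n⇒∣m+n ∣-refl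
      (partition⇒∣ m Class props meet k rest rest≤ (filter⁺ (¬? ∘ (_∈? c)) u) classOf′))
    where
    rest : List A
    rest = filter (¬? ∘ (_∈? c)) (x ∷ xs)
    total : suc (length xs) ≡ m + length rest
    total = trans (length-filter-¬ (_∈? c) (x ∷ xs)) (cong (_+ length rest) (trans (length-common u c! c⊆) |c|≡m))
    m>0 : ∀ {c} → length c ≡ m → x ∈ c → 1 ≤ m
    m>0 {_ ∷ _} refl _ = s≤s z≤n
    rest≤ : length rest ≤ k
    rest≤ = s≤s⁻¹ (≤-trans (+-monoˡ-≤ (length rest) (m>0 |c|≡m x∈c)) (≤-trans (≤-reflexive (≡sym total)) l≤))
    classOf′ : ∀ {z} → z ∈ rest → ∃[ c′ ] Class z c′ × (∀ {w} → w ∈ c′ → w ∈ rest)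
    classOf′ z∈ with ∈-filter⁻ (¬? ∘ (_∈? c)) {xs = x ∷ xs} z∈
    ... | z∈xs , z∉c with classOf z∈xs
    ... | c′ , Cz , c′⊆ = c′ , Cz , λ w∈c′ → ∈-filter⁺ (¬? ∘ (_∈? c)) (c′⊆ w∈c′) (λ w∈c → z∉c (meet Cx Cz w∈c w∈c′))

-- Nonbacktracking walks

indicator : Bool → ℕ
indicator true  = 1
indicator false = 0

length-filter-tabulate : ∀ {n} {A : Set} (b : A → Bool) (g : Fin n → A) →
  length (filter (λ x → T? (b x)) (tabulate g)) ≡ ∑ (λ i → indicator (b (g i)))
length-filter-tabulate {zero}  b g = refl
length-filter-tabulate {suc n} b g with b (g zero)
... | true  = cong suc (length-filter-tabulate b (g ∘ suc))
... | false = length-filter-tabulate b (g ∘ suc)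

module Walks {n : ℕ} (Γ : Graph n) where

  V : Set
  V = Fin n

  infix 4 _~_
  _~_ : V → V → Set
  u ~ v = T (adj Γ u v)

  a : Matrix n
  a u v = indicator (adj Γ u v)

  ~-sym : ∀ {u v} → u ~ v → v ~ u
  ~-sym {u} {v} = subst T (sym Γ u v)

  ~⇒≢ : ∀ {u v} → u ~ v → u ≢ v
  ~⇒≢ {u} u~u refl = subst T (irrefl Γ u) u~u

  a-sym : ∀ u v → a u v ≡ a v u
  a-sym u v = cong indicator (sym Γ u v)

  ~⇒a : ∀ {u v} → u ~ v → a u v ≡ 1
  ~⇒a {u} {v} u~v with adj Γ u v
  ... | true = refl

  a⇒~ : ∀ {u v} → 1 ≤ a u v → u ~ v
  a⇒~ {u} {v} p with adj Γ u v
  ... | true = tt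

  a≤1 : ∀ u v → a u v ≤ 1
  a≤1 u v with adj Γ u v
  ... | true  = s≤s z≤n
  ... | false = z≤n

  a-guard : ∀ {u v x y} → (u ~ v → x ≡ y) → a u v * x ≡ a u v * y
  a-guard {u} {v} eq with adj Γ u v
  ... | true  = cong (1 *_) (eq tt)
  ... | false = refl

  a-guard-≤ : ∀ {u v x y} → (u ~ v → x ≤ y) → a u v * x ≤ a u v * y
  a-guard-≤ {u} {v} le with adj Γ u v
  ... | true  = *-monoʳ-≤ 1 (le tt)
  ... | false = z≤n

  a*-positive : ∀ {u v x} → 1 ≤ a u v * x → u ~ v × 1 ≤ x
  a*-positive {u} {v} {x} p with adj Γ u v
  ... | true = tt , subst (1 ≤_) (+-identityʳ x) p

  degree-∑ : ∀ v → degree Γ v ≡ ∑ (a v)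
  degree-∑ v = length-filter-tabulate (adj Γ v) id

  -- Wk u v k x y: a nonbacktracking walk with k + 1 edges whose first edge is
  -- u → v and whose last edge is x → y.
  data Wk : V → V → ℕ → V → V → Set where
    nil  : ∀ {u v} → u ~ v → Wk u v 0 u v
    cons : ∀ {u v w k x y} → u ~ v → u ≢ w → Wk v w k x y → Wk u v (suc k) x y

  snoc : ∀ {u v k x y z} → Wk u v k x y → x ≢ z → y ~ z → Wk u v (suc k) y z
  snoc (nil u~v)        x≢z y~z = cons u~v x≢z (nil y~z)
  snoc (cons u~v u≢w p) x≢z y~z = cons u~v u≢w (snoc p x≢z y~z)

  rev : ∀ {u v k x y} → Wk u v k x y → Wk y x k v u
  rev (nil u~v)        = nil (~-sym u~v)
  rev (cons u~v u≢w p) = snoc (rev p) (u≢w ∘ ≡sym) (~-sym u~v)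

  join : ∀ {u v i x y z j s t} → Wk u v i x y → x ≢ z → Wk y z j s t → Wk u v (suc (i + j)) s t
  join (nil u~v)        x≢z q = cons u~v x≢z q
  join (cons u~v u≢w p) x≢z q = cons u~v u≢w (join p x≢z q)

  first : ∀ {u v k x y} → Wk u v k x y → u ~ v
  first (nil u~v)      = u~v
  first (cons u~v _ _) = u~v

  last : ∀ {u v k x y} → Wk u v k x y → x ~ y
  last (nil u~v)    = u~v
  last (cons _ _ p) = last p

  opaque

    -- P k u v t counts the nonbacktracking walks with k + 1 edges from u to t
    -- that start with u → v, provided that u ~ v; F k and S k count the
    -- nonbacktracking walks of length k and of length at most k.
    P : ℕ → V → V → V → ℕ
    P zero    u v t = δ v t
    P (suc k) u v t = ∑ (mask u (λ w → a v w * P k v w t))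

    F : ℕ → Matrix n
    F zero    u t = δ u t
    F (suc k) u t = ∑ (λ v → a u v * P k u v t)

    S : ℕ → Matrix n
    S zero    = F zero
    S (suc k) = F (suc k) ⊞ S k

    Wk⇒P : ∀ {u v k x t} → Wk u v k x t → 1 ≤ P k u v t
    Wk⇒P {v = v} (nil _) rewrite δ-diag v = s≤s z≤n
    Wk⇒P {u} {v} {suc k} {t = t} (cons {w = w} u~v u≢w p) = begin
      1                      ≤⟨ Wk⇒P p ⟩
      P k v w t              ≡⟨ trans (cong (_* P k v w t) (~⇒a (first p))) (+-identityʳ _) ⟨
      a v w * P k v w t      ≡⟨ mask-off (λ w → a v w * P k v w t) u≢w ⟨
      mask u (λ w → a v w * P k v w t) w ≤⟨ term≤∑ (mask u (λ w → a v w * P k v w t)) w ⟩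
      P (suc k) u v t        ∎
      where open ≤-Reasoning

    P⇒Wk : ∀ k {u v t} → u ~ v → 1 ≤ P k u v t → ∃[ x ] Wk u v k x t
    P⇒Wk zero {u} {v} {t} u~v p with v ≟F t
    ... | yes refl = u , nil u~v
    P⇒Wk (suc k) {u} {v} {t} u~v p with ∑-positive (mask u (λ w → a v w * P k v w t)) p
    ... | w , q with mask-positive (λ w → a v w * P k v w t) q
    ... | u≢w , r with a*-positive r
    ... | v~w , s with P⇒Wk k v~w s
    ... | x , p′ = x , cons u~v u≢w p′

    Wk⇒aP : ∀ {u v k x t} → Wk u v k x t → 1 ≤ a u v * P k u v t
    Wk⇒aP p rewrite ~⇒a (first p) = subst (1 ≤_) (≡sym (+-identityʳ _)) (Wk⇒P p)

    Wk⇒F : ∀ {u v k x t} → Wk u v k x t → 1 ≤ F (suc k) u t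
    Wk⇒F {v = v} p = ≤-trans (Wk⇒aP p) (term≤∑ _ v)

    aP⇒Wk : ∀ k {u v t} → 1 ≤ a u v * P k u v t → ∃[ x ] Wk u v k x t
    aP⇒Wk k p with a*-positive p
    ... | u~v , q = P⇒Wk k u~v q

    F⇒Wk : ∀ k {u t} → 1 ≤ F (suc k) u t → ∃[ v ] ∃[ x ] Wk u v k x t
    F⇒Wk k {u} {t} p with ∑-positive (λ v → a u v * P k u v t) p
    ... | v , q = v , aP⇒Wk k q

    F≤S : ∀ {i k} → i ≤ k → ∀ u t → F i u t ≤ S k u t
    F≤S {zero}  {zero}  _   u t = ≤-refl
    F≤S {i}     {suc k} i≤k u t with m≤n⇒m<n∨m≡n i≤k
    ... | inj₁ i<sk = ≤-trans (F≤S (s≤s⁻¹ i<sk) u t) (m≤n+m _ _)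
    ... | inj₂ refl = m≤m+n _ _

    two-F≤S : ∀ {i j k} → i < j → j ≤ k → ∀ u t → F i u t + F j u t ≤ S k u t
    two-F≤S {i} {suc j} {suc k} i<j j≤k u t with m≤n⇒m<n∨m≡n j≤k
    ... | inj₁ j<sk = ≤-trans (two-F≤S i<j (s≤s⁻¹ j<sk) u t) (m≤n+m _ _)
    ... | inj₂ refl = subst (_≤ S (suc j) u t) (+-comm (F (suc j) u t) (F i u t))
                                 (+-monoʳ-≤ (F (suc j) u t) (F≤S (s≤s⁻¹ i<j) u t))

    -- Each edge is put in front of the already reduced rest of the walk; if this would backtrack,
    -- it cancels against the first edge of that rest.
    Walk⇒F : ∀ {u v k} → Walk Γ u v k → ∃[ j ] j ≤ k × 1 ≤ F j u v
    Walk⇒F {u} here = 0 , z≤n , subst (1 ≤_) (≡sym (δ-diag u)) (s≤s z≤n)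
    Walk⇒F {u} {v} (step {w = w} u~w p) with Walk⇒F p
    ... | zero , j≤k , q with w ≟F v
    ...   | yes refl = 1 , s≤s z≤n , Wk⇒F (nil u~w)
    Walk⇒F {u} {v} (step {w = w} u~w p) | suc j , j≤k , q with F⇒Wk j q
    ...   | x , y , r with u ≟F x
    ...     | no u≢x = suc (suc j) , s≤s j≤k , Wk⇒F (cons u~w u≢x r)
    Walk⇒F {u} {v} (step {w = w} u~w p) | suc j , j≤k , q | x , y , r | yes refl with r
    ...       | nil _ = 0 , z≤n , subst (1 ≤_) (≡sym (δ-diag u)) (s≤s z≤n)
    ...       | cons _ _ r′ = _ , m≤n⇒m≤1+n (≤-trans (n≤1+n _) j≤k) , Wk⇒F r′

    P-step : ∀ k u v t → F (suc k) v t ≡ a v u * P k v u t + P (suc k) u v t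
    P-step k u v t = ∑-split (λ w → a v w * P k v w t) u

    aaF : ∀ u v x → a u v * (a v u * x) ≡ a u v * x
    aaF u v x = a-guard (λ u~v → trans (cong (_* x) (~⇒a (~-sym u~v))) (+-identityʳ x))

    -- A walk from `v` preceded by `u → v` stays nonbacktracking unless it starts with `v → u`; the
    -- second sum collects these exceptions.
    A∙F : ∀ k u t → (a ∙ F (suc k)) u t ≡ F (suc (suc k)) u t + ∑ (λ v → a u v * P k v u t)
    A∙F k u t = begin
      ∑ (λ v → a u v * F (suc k) v t)
        ≡⟨ sum-cong-≗ (λ v → trans (cong (a u v *_) (P-step k u v t)) (*-distribˡ-+ (a u v) _ _)) ⟩
      ∑ (λ v → a u v * (a v u * P k v u t) + a u v * P (suc k) u v t)
        ≡⟨ sum-cong-≗ (λ v → trans (+-comm (a u v * (a v u * P k v u t)) _) (cong (a u v * P (suc k) u v t +_) (aaF u v _))) ⟩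
      ∑ (λ v → a u v * P (suc k) u v t + a u v * P k v u t)
        ≡⟨ ∑-distrib-+ (λ v → a u v * P (suc k) u v t) (λ v → a u v * P k v u t) ⟩
      F (suc (suc k)) u t + ∑ (λ v → a u v * P k v u t) ∎
      where open ≡-Reasoning

  module Bounded (q : ℕ) (bound : ∀ v → ∑ (a v) ≤ suc q) where

    opaque
      unfolding P F S

      rowP : ∀ k {u v} → u ~ v → ∑ (P k u v) ≤ q ^ k
      rowP zero {u} {v} _ = ≤-reflexive (∑-δ v)
      rowP (suc k) {u} {v} u~v = begin
        ∑ (λ t → ∑ (λ w → mask u (λ w → a v w * P k v w t) w)) ≡⟨ ∑-comm (λ t w → mask u (λ w → a v w * P k v w t) w) ⟩
        ∑ (λ w → ∑ (λ t → mask u (λ w → a v w * P k v w t) w)) ≤⟨ ∑-mono inner ⟩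
        ∑ (λ w → mask u (a v) w * q ^ k)                       ≡⟨ *-distribʳ-sum (q ^ k) (mask u (a v)) ⟨
        ∑ (mask u (a v)) * q ^ k                               ≤⟨ *-monoˡ-≤ (q ^ k) others ⟩
        q * q ^ k                                              ∎
        where
        open ≤-Reasoning
        others : ∑ (mask u (a v)) ≤ q
        others = s≤s⁻¹ (subst (_≤ suc q) (trans (∑-split (a v) u) (cong (_+ ∑ (mask u (a v))) (~⇒a (~-sym u~v)))) (bound v))
        inner : ∀ w → ∑ (λ t → mask u (λ w → a v w * P k v w t) w) ≤ mask u (a v) w * q ^ k
        inner w with u ≟F w
        ... | yes _ = ≤-reflexive (∑-zero {n})
        ... | no _  = begin
          ∑ (λ t → a v w * P k v w t) ≡⟨ *-distribˡ-sum (a v w) (P k v w) ⟨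
          a v w * ∑ (P k v w)         ≤⟨ a-guard-≤ (rowP k) ⟩
          a v w * q ^ k               ∎

      rowF : ∀ k u → ∑ (F (suc k) u) ≤ ∑ (a u) * q ^ k
      rowF k u = begin
        ∑ (λ t → ∑ (λ v → a u v * P k u v t)) ≡⟨ ∑-comm (λ t v → a u v * P k u v t) ⟩
        ∑ (λ v → ∑ (λ t → a u v * P k u v t)) ≡⟨ sum-cong-≗ (λ v → *-distribˡ-sum (a u v) (P k u v)) ⟨
        ∑ (λ v → a u v * ∑ (P k u v))         ≤⟨ ∑-mono {n} (λ v → a-guard-≤ {u} {v} (rowP k)) ⟩
        ∑ (λ v → a u v * q ^ k)               ≡⟨ *-distribʳ-sum (q ^ k) (a u) ⟨
        ∑ (a u) * q ^ k                       ∎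
        where open ≤-Reasoning

      -- The degree of `u` itself enters exactly and only the later degrees are estimated, so that a
      -- vertex of small degree is seen to reach too few vertices.
      rowS : ∀ k u → ∑ (S k u) ≤ 1 + ∑ (a u) * geomSum q k
      rowS zero u = ≤-reflexive (trans (∑-δ u) (cong suc (≡sym (*-zeroʳ (∑ (a u))))))
      rowS (suc k) u = begin
        ∑ (λ t → F (suc k) u t + S k u t)   ≡⟨ ∑-distrib-+ (F (suc k) u) (S k u) ⟩
        ∑ (F (suc k) u) + ∑ (S k u)         ≤⟨ +-mono-≤ (rowF k u) (rowS k u) ⟩
        m * q ^ k + suc (m * geomSum q k)   ≡⟨ +-suc (m * q ^ k) _ ⟩
        suc (m * q ^ k + m * geomSum q k)   ≡⟨ cong suc (*-distribˡ-+ m (q ^ k) _) ⟨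
        1 + m * (q ^ k + geomSum q k)       ∎
        where
        open ≤-Reasoning
        m : ℕ
        m = ∑ (a u)

  module Regular (q : ℕ) (regular : ∀ v → ∑ (a v) ≡ suc q) where

    -- The number of neighbours of `u` from which a given nonbacktracking walk of length `k`
    -- starting at `u` can be entered: all of them for `k = 0`, otherwise all but the second vertex
    -- of the walk.
    κ : ℕ → ℕ
    κ zero    = suc q
    κ (suc _) = q

    Commutes : Matrix n → Set
    Commutes X = a ∙ X ≋ X ∙ a

    opaque
      unfolding P F S

      A∙F-rec : ∀ k → a ∙ F (suc k) ≋ F (suc (suc k)) ⊞ κ k ⊡ F k
      A∙F-rec k u t = trans (A∙F k u t) (cong (F (suc (suc k)) u t +_) (back k))
        where
        open ≡-Reasoning
        back : ∀ k → ∑ (λ v → a u v * P k v u t) ≡ κ k * F k u t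
        back zero = trans (≡sym (*-distribʳ-sum (δ u t) (a u))) (cong (_* δ u t) (regular u))
        -- The forbidden neighbour is added on both sides. Then every neighbour of `u` is allowed,
        -- and the total is the degree times `F (suc k) u t`.
        back (suc k) = +-cancelʳ-≡ (F (suc k) u t) _ _ (begin
          ∑ (λ v → a u v * P (suc k) v u t) + ∑ (λ v → a u v * P k u v t)
            ≡⟨ ∑-distrib-+ (λ v → a u v * P (suc k) v u t) (λ v → a u v * P k u v t) ⟨
          ∑ (λ v → a u v * P (suc k) v u t + a u v * P k u v t)
            ≡⟨ sum-cong-≗ (λ v → ≡sym (trans (cong (a u v *_) (P-step k v u t))
                 (trans (*-distribˡ-+ (a u v) (a u v * P k u v t) (P (suc k) v u t))
                 (trans (+-comm (a u v * (a u v * P k u v t)) _)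
                   (cong (a u v * P (suc k) v u t +_)
                     (a-guard (λ u~v → trans (cong (_* P k u v t) (~⇒a u~v)) (+-identityʳ _)))))))) ⟩
          ∑ (λ v → a u v * F (suc k) u t)
            ≡⟨ *-distribʳ-sum (F (suc k) u t) (a u) ⟨
          ∑ (a u) * F (suc k) u t
            ≡⟨ cong (_* F (suc k) u t) (regular u) ⟩
          F (suc k) u t + q * F (suc k) u t
            ≡⟨ +-comm (F (suc k) u t) _ ⟩
          q * F (suc k) u t + F (suc k) u t ∎)

      F₁ : F 1 ≋ a
      F₁ u t = ∑-δʳ t (a u)

      -- By `A∙F-rec`, `F k` is a polynomial in `a`. In the natural numbers the lower term of the
      -- recurrence is cancelled rather than subtracted.
      F-commutes : ∀ X → Commutes X → ∀ k → F k ∙ X ≋ X ∙ F k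
      F-commutes X comm zero u v = trans (∑-δˡ u (λ w → X w v)) (≡sym (∑-δʳ v (X u)))
      F-commutes X comm (suc zero) u v =
        trans (∙-congʳ X F₁ u v) (trans (comm u v) (≡sym (∙-congˡ X F₁ u v)))
      F-commutes X comm (suc (suc k)) u v = +-cancelʳ-≡ (κ k * (F k ∙ X) u v) _ _ (begin
        (F₂ ∙ X) u v + κ k * (F k ∙ X) u v   ≡⟨ cong ((F₂ ∙ X) u v +_) (∙-⊡ˡ (κ k) (F k) X u v) ⟨
        (F₂ ∙ X) u v + (κ k ⊡ F k ∙ X) u v   ≡⟨ ∙-distribʳ-⊞ X F₂ (κ k ⊡ F k) u v ⟨
        ((F₂ ⊞ κ k ⊡ F k) ∙ X) u v           ≡⟨ ∙-congʳ X (A∙F-rec k) u v ⟨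
        (a ∙ F (suc k) ∙ X) u v              ≡⟨ ∙-assoc a (F (suc k)) X u v ⟩
        (a ∙ (F (suc k) ∙ X)) u v            ≡⟨ ∙-congˡ a (F-commutes X comm (suc k)) u v ⟩
        (a ∙ (X ∙ F (suc k))) u v            ≡⟨ ∙-assoc a X (F (suc k)) u v ⟨
        (a ∙ X ∙ F (suc k)) u v              ≡⟨ ∙-congʳ (F (suc k)) comm u v ⟩
        (X ∙ a ∙ F (suc k)) u v              ≡⟨ ∙-assoc X a (F (suc k)) u v ⟩
        (X ∙ (a ∙ F (suc k))) u v            ≡⟨ ∙-congˡ X (A∙F-rec k) u v ⟩
        (X ∙ (F₂ ⊞ κ k ⊡ F k)) u v           ≡⟨ ∙-distribˡ-⊞ X F₂ (κ k ⊡ F k) u v ⟩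
        (X ∙ F₂) u v + (X ∙ κ k ⊡ F k) u v   ≡⟨ cong ((X ∙ F₂) u v +_) (∙-⊡ʳ (κ k) X (F k) u v) ⟩
        (X ∙ F₂) u v + κ k * (X ∙ F k) u v   ≡⟨ cong (λ x → (X ∙ F₂) u v + κ k * x) (F-commutes X comm k u v) ⟨
        (X ∙ F₂) u v + κ k * (F k ∙ X) u v   ∎)
        where
        open ≡-Reasoning
        F₂ : Matrix n
        F₂ = F (suc (suc k))

      F∙a : ∀ k → F k ∙ a ≋ a ∙ F k
      F∙a = F-commutes a (λ _ _ → refl)

      F-sym : ∀ k u v → F k u v ≡ F k v u
      F-sym zero u v = δ-sym u v
      F-sym (suc zero) u v = trans (F₁ u v) (trans (a-sym u v) (≡sym (F₁ v u)))
      F-sym (suc (suc k)) u v = +-cancelʳ-≡ (κ k * F k u v) _ _ (begin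
        F (suc (suc k)) u v + κ k * F k u v ≡⟨ A∙F-rec k u v ⟨
        (a ∙ F (suc k)) u v                 ≡⟨ sum-cong-≗ (λ w → trans (*-comm (a u w) _) (cong₂ _*_ (F-sym (suc k) w v) (a-sym u w))) ⟩
        (F (suc k) ∙ a) v u                 ≡⟨ F∙a (suc k) v u ⟩
        (a ∙ F (suc k)) v u                 ≡⟨ A∙F-rec k v u ⟩
        F (suc (suc k)) v u + κ k * F k v u ≡⟨ cong (λ x → F (suc (suc k)) v u + κ k * x) (F-sym k v u) ⟩
        F (suc (suc k)) v u + κ k * F k u v ∎)
        where open ≡-Reasoning

      S-sym : ∀ k u v → S k u v ≡ S k v u
      S-sym zero    u v = F-sym zero u v
      S-sym (suc k) u v = cong₂ _+_ (F-sym (suc k) u v) (S-sym k u v)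

      a∙S : ∀ k → a ∙ S k ≋ S k ∙ a
      a∙S zero    u v = ≡sym (F∙a zero u v)
      a∙S (suc k) u v = trans (∙-distribˡ-⊞ a (F (suc k)) (S k) u v)
        (trans (cong₂ _+_ (≡sym (F∙a (suc k) u v)) (a∙S k u v)) (≡sym (∙-distribʳ-⊞ a (F (suc k)) (S k) u v)))

      -- A nonbacktracking walk to t has at least q nonbacktracking extensions.
      q*S≤a∙S : ∀ k u t → q * S k u t ≤ (a ∙ S (suc k)) u t
      q*S≤a∙S zero u t = begin
        q * F 0 u t                     ≤⟨ *-monoˡ-≤ (F 0 u t) (n≤1+n q) ⟩
        suc q * F 0 u t                 ≤⟨ m≤n+m _ (F 2 u t) ⟩
        F 2 u t + κ 0 * F 0 u t         ≡⟨ A∙F-rec 0 u t ⟨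
        (a ∙ F 1) u t                   ≤⟨ m≤m+n _ _ ⟩
        (a ∙ F 1) u t + (a ∙ F 0) u t   ≡⟨ ∙-distribˡ-⊞ a (F 1) (F 0) u t ⟨
        (a ∙ S 1) u t                   ∎
        where open ≤-Reasoning
      q*S≤a∙S (suc k) u t = begin
        q * (F (suc k) u t + S k u t)                     ≡⟨ *-distribˡ-+ q (F (suc k) u t) _ ⟩
        q * F (suc k) u t + q * S k u t                   ≤⟨ +-mono-≤ (m≤n+m _ (F (suc (suc (suc k))) u t)) (q*S≤a∙S k u t) ⟩
        F (suc (suc (suc k))) u t + q * F (suc k) u t + (a ∙ S (suc k)) u t ≡⟨ cong (_+ (a ∙ S (suc k)) u t) (A∙F-rec (suc k) u t) ⟨
        (a ∙ F (suc (suc k))) u t + (a ∙ S (suc k)) u t   ≡⟨ ∙-distribˡ-⊞ a (F (suc (suc k))) (S (suc k)) u t ⟨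
        (a ∙ S (suc (suc k))) u t                         ∎
        where open ≤-Reasoning

      rowF≡ : ∀ k u → ∑ (F (suc k) u) ≡ suc q * q ^ k
      rowF≡ zero u = trans (sum-cong-≗ (F₁ u)) (trans (regular u) (≡sym (*-identityʳ (suc q))))
      rowF≡ (suc k) u = +-cancelʳ-≡ (κ k * ∑ (F k u)) _ _ (begin
        ∑ (F (suc (suc k)) u) + κ k * ∑ (F k u)
          ≡⟨ cong (∑ (F (suc (suc k)) u) +_) (*-distribˡ-sum (κ k) (F k u)) ⟩
        ∑ (F (suc (suc k)) u) + ∑ (λ t → κ k * F k u t)
          ≡⟨ ∑-distrib-+ (F (suc (suc k)) u) (λ t → κ k * F k u t) ⟨
        ∑ (λ t → F (suc (suc k)) u t + κ k * F k u t)
          ≡⟨ sum-cong-≗ (A∙F-rec k u) ⟨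
        ∑ (λ t → ∑ (λ v → a u v * F (suc k) v t))
          ≡⟨ ∑-comm (λ t v → a u v * F (suc k) v t) ⟩
        ∑ (λ v → ∑ (λ t → a u v * F (suc k) v t))
          ≡⟨ sum-cong-≗ (λ v → trans (≡sym (*-distribˡ-sum (a u v) (F (suc k) v))) (cong (a u v *_) (rowF≡ k v))) ⟩
        ∑ (λ v → a u v * (suc q * q ^ k))
          ≡⟨ *-distribʳ-sum (suc q * q ^ k) (a u) ⟨
        ∑ (a u) * (suc q * q ^ k)
          ≡⟨ cong (_* (suc q * q ^ k)) (regular u) ⟩
        suc q * (suc q * q ^ k)
          ≡⟨ arith k ⟩
        suc q * q ^ suc k + κ k * ∑ (F k u) ∎)
        where
        open ≡-Reasoning
        arith : ∀ k → suc q * (suc q * q ^ k) ≡ suc q * q ^ suc k + κ k * ∑ (F k u)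
        arith zero = begin
          suc q * (suc q * 1)              ≡⟨ cong (suc q *_) (trans (+-comm 1 (q * 1)) (cong (q * 1 +_) (≡sym (∑-δ u)))) ⟩
          suc q * (q * 1 + ∑ (F 0 u))      ≡⟨ *-distribˡ-+ (suc q) (q * 1) _ ⟩
          suc q * q ^ 1 + suc q * ∑ (F 0 u) ∎
        arith (suc k) = begin
          suc q * (q ^ suc k + q * q ^ suc k)         ≡⟨ cong (suc q *_) (+-comm (q ^ suc k) _) ⟩
          suc q * (q * q ^ suc k + q ^ suc k)         ≡⟨ *-distribˡ-+ (suc q) (q * q ^ suc k) _ ⟩
          suc q * (q * q ^ suc k) + suc q * (q * q ^ k) ≡⟨ cong (suc q * (q * q ^ suc k) +_)
               (trans (≡sym (*-assoc (suc q) q _)) (trans (cong (_* q ^ k) (*-comm (suc q) q)) (*-assoc q (suc q) _))) ⟩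
          suc q * (q * q ^ suc k) + q * (suc q * q ^ k) ≡⟨ cong (λ x → suc q * (q * q ^ suc k) + q * x) (rowF≡ k u) ⟨
          suc q * (q * q ^ suc k) + q * ∑ (F (suc k) u) ∎

      rowS≡ : ∀ k u → ∑ (S k u) ≡ 1 + suc q * geomSum q k
      rowS≡ zero u = trans (∑-δ u) (cong suc (≡sym (*-zeroʳ (suc q))))
      rowS≡ (suc k) u = begin
        ∑ (λ t → F (suc k) u t + S k u t)   ≡⟨ ∑-distrib-+ (F (suc k) u) (S k u) ⟩
        ∑ (F (suc k) u) + ∑ (S k u)         ≡⟨ cong₂ _+_ (rowF≡ k u) (rowS≡ k u) ⟩
        suc q * q ^ k + suc (suc q * geomSum q k) ≡⟨ +-suc (suc q * q ^ k) _ ⟩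
        suc (suc q * q ^ k + suc q * geomSum q k) ≡⟨ cong suc (*-distribˡ-+ (suc q) (q ^ k) _) ⟨
        1 + suc q * (q ^ k + geomSum q k)   ∎
        where open ≡-Reasoning

-- Closed walks as periodic sequences

module Cycles {n : ℕ} (Γ : Graph n) where

  open Walks Γ

  -- An infinite periodic sequence makes rotation an addition of indices. Vertices may recur within
  -- a period; only backtracking is excluded.
  record Cycle (m : ℕ) : Set where
    field
      at       : ℕ → V
      adjacent : ∀ i → at i ~ at (suc i)
      turning  : ∀ i → at i ≢ at (2 + i)
      periodic : ∀ i → at (i + m) ≡ at i

  open Cycle public

  shift : ∀ {m} → ℕ → Cycle m → Cycle m
  shift     i C .at j       = at C (j + i)
  shift     i C .adjacent j = adjacent C (j + i)
  shift     i C .turning j  = turning C (j + i)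
  shift {m} i C .periodic j = trans (cong (at C) (begin
      j + m + i   ≡⟨ +-assoc j m i ⟩
      j + (m + i) ≡⟨ cong (j +_) (+-comm m i) ⟩
      j + (i + m) ≡⟨ +-assoc j i m ⟨
      j + i + m   ∎)) (periodic C (j + i))
    where open ≡-Reasoning

  segment : ∀ {m} (C : Cycle m) k → Wk (at C 0) (at C 1) k (at C k) (at C (suc k))
  segment C zero    = nil (adjacent C 0)
  segment C (suc k) = snoc (segment C k) (turning C k) (adjacent C (suc k))

  periodic* : ∀ {m} (C : Cycle m) i k → at C (i + k * m) ≡ at C i
  periodic*     C i zero    = cong (at C) (+-identityʳ i)
  periodic* {m} C i (suc k) = trans (cong (at C) (begin
      i + (m + k * m) ≡⟨ cong (i +_) (+-comm m _) ⟩
      i + (k * m + m) ≡⟨ +-assoc i (k * m) m ⟨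
      i + k * m + m   ∎)) (trans (periodic C (i + k * m)) (periodic* C i k))
    where open ≡-Reasoning

  reduce : ∀ {m} .{{_ : NonZero m}} (C : Cycle m) i → ∃[ j ] j < m × at C j ≡ at C i
  reduce {m} C i = i % m , m%n<n i m ,
    trans (≡sym (periodic* C (i % m) (i / m))) (cong (at C) (≡sym (m≡m%n+[m/n]*n i m)))

  vertex : ∀ {u v k x y} → Wk u v k x y → ℕ → V
  vertex {u}     (nil _)      zero    = u
  vertex {v = v} (nil _)      (suc _) = v
  vertex {u}     (cons _ _ p) zero    = u
  vertex         (cons _ _ p) (suc i) = vertex p i

  vertex-start : ∀ {u v k x y} (p : Wk u v k x y) → vertex p 0 ≡ u
  vertex-start (nil _)      = refl
  vertex-start (cons _ _ _) = refl

  vertex-penultimate : ∀ {u v k x y} (p : Wk u v k x y) → vertex p k ≡ x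
  vertex-penultimate (nil _)      = refl
  vertex-penultimate (cons _ _ p) = vertex-penultimate p

  vertex-snoc : ∀ {u v k x y z} (p : Wk u v k x y) (x≢z : x ≢ z) (y~z : y ~ z) {i} → i ≤ suc k →
    vertex (snoc p x≢z y~z) i ≡ vertex p i
  vertex-snoc (nil _)      _   _   {zero}        _         = refl
  vertex-snoc (nil _)      _   _   {suc zero}    _         = refl
  vertex-snoc (nil _)      _   _   {suc (suc _)} (s≤s ())
  vertex-snoc (cons _ _ p) _   _   {zero}        _         = refl
  vertex-snoc (cons _ _ p) x≢z y~z {suc i}       (s≤s i≤k) = vertex-snoc p x≢z y~z i≤k

  vertex-join : ∀ {u v i x y z j s t} (p : Wk u v i x y) (x≢z : x ≢ z) (r : Wk y z j s t) →
    vertex (join p x≢z r) (suc i) ≡ y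
  vertex-join (nil _)      x≢z r = vertex-start r
  vertex-join (cons _ _ p) x≢z r = vertex-join p x≢z r

  module _ {k : ℕ} where

    -- The type `Wk u v (suc k) u v` describes a closed walk of length `suc k` followed by its first
    -- edge once more, so that it does not backtrack at the seam either. Dropping the first edge and
    -- appending the next one rotates it.
    next : ∀ {u v} → Wk u v (suc k) u v → ∃[ w ] Wk v w (suc k) v w
    next (cons {w = w} u~v u≢w p) = w , snoc p u≢w (first p)

    unroll : ∀ {u v} → Wk u v (suc k) u v → ℕ → V
    unroll {u} c zero    = u
    unroll     c (suc i) = unroll (proj₂ (next c)) i

    unroll-vertex : ∀ {u v} (c : Wk u v (suc k) u v) {i} → i ≤ suc k → unroll c i ≡ vertex c i
    unroll-vertex c@(cons _ _ _) {zero}  _ = refl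
    unroll-vertex c@(cons {w = w} u~v u≢w p) {suc i} (s≤s i≤k) =
      trans (unroll-vertex (proj₂ (next c)) (m≤n⇒m≤1+n i≤k)) (vertex-snoc p u≢w (first p) (m≤n⇒m≤1+n i≤k))

    closed⇒cycle : ∀ {u v} → Wk u v (suc k) u v → Cycle (suc k)
    closed⇒cycle c .at = unroll c
    closed⇒cycle c@(cons u~v _ _) .adjacent zero    = u~v
    closed⇒cycle c                .adjacent (suc i) = closed⇒cycle (proj₂ (next c)) .adjacent i
    closed⇒cycle c@(cons _ u≢w _) .turning zero     = u≢w
    closed⇒cycle c                .turning (suc i)  = closed⇒cycle (proj₂ (next c)) .turning i
    closed⇒cycle c .periodic zero    = trans (unroll-vertex c ≤-refl) (vertex-penultimate c)
    closed⇒cycle c .periodic (suc i) = closed⇒cycle (proj₂ (next c)) .periodic i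

-- Graphs of defect 2

module Defect {n : ℕ} (Γ : Graph n) (q e : ℕ) (4≤q : 4 ≤ q)
  (regular : ∀ v → ∑ (Walks.a Γ v) ≡ suc q)
  (connected : ∀ u t → 1 ≤ Walks.S Γ (4 + e) u t)
  (order : n + 2 ≡ 1 + suc q * geomSum q (4 + e))
  where

  open Walks Γ
  open Cycles Γ
  open Regular q regular

  D : ℕ
  D = 4 + e

  opaque

    -- t is called a repeat of u if 1 ≤ B u t.
    B : Matrix n
    B u t = S D u t ∸ 1

    S≡1+B : ∀ u t → S D u t ≡ suc (B u t)
    S≡1+B u t = ≡sym (m+[n∸m]≡n (connected u t))

    B-sym : ∀ u t → B u t ≡ B t u
    B-sym u t = cong (_∸ 1) (S-sym D u t)

  rowB : ∀ u → ∑ (B u) ≡ 2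
  rowB u = +-cancelˡ-≡ n _ _ (begin
    n + ∑ (B u)                     ≡⟨ cong (_+ ∑ (B u)) (trans (∑-const {n} 1) (*-identityʳ n)) ⟨
    ∑ {n} (λ _ → 1) + ∑ (B u)       ≡⟨ ∑-distrib-+ (λ _ → 1) (B u) ⟨
    ∑ (λ t → suc (B u t))           ≡⟨ sum-cong-≗ (S≡1+B u) ⟨
    ∑ (S D u)                       ≡⟨ rowS≡ D u ⟩
    1 + suc q * geomSum q D         ≡⟨ order ⟨
    n + 2                           ∎)
    where open ≡-Reasoning

  B-flip : ∀ {u t} → 1 ≤ B u t → 1 ≤ B t u
  B-flip {u} {t} = subst (1 ≤_) (B-sym u t)

  J : Matrix n
  J _ _ = 1

  a∙S≡ : ∀ u t → (a ∙ S D) u t ≡ suc q + (a ∙ B) u t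
  a∙S≡ u t = begin
    (a ∙ S D) u t               ≡⟨ ∙-congˡ a S≡1+B u t ⟩
    (a ∙ (J ⊞ B)) u t           ≡⟨ ∙-distribˡ-⊞ a J B u t ⟩
    (a ∙ J) u t + (a ∙ B) u t   ≡⟨ cong (_+ (a ∙ B) u t) (trans (sum-cong-≗ (λ w → *-identityʳ (a u w))) (regular u)) ⟩
    suc q + (a ∙ B) u t         ∎
    where open ≡-Reasoning

  -- `S D` commutes with `a` as a sum of polynomials in `a`, and `J` does so by regularity; `B` is
  -- their difference.
  B-commutes : Commutes B
  B-commutes u t = +-cancelˡ-≡ (suc q) _ _ (begin
    suc q + (a ∙ B) u t         ≡⟨ a∙S≡ u t ⟨
    (a ∙ S D) u t               ≡⟨ a∙S D u t ⟩
    (S D ∙ a) u t               ≡⟨ ∙-congʳ a S≡1+B u t ⟩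
    ((J ⊞ B) ∙ a) u t           ≡⟨ ∙-distribʳ-⊞ a J B u t ⟩
    (J ∙ a) u t + (B ∙ a) u t   ≡⟨ cong (_+ (B ∙ a) u t) (trans (sum-cong-≗ (λ w → trans (+-identityʳ _) (a-sym w t))) (regular t)) ⟩
    suc q + (B ∙ a) u t         ∎)
    where open ≡-Reasoning

  -- Two walks of length at most D − 1 from u to t would have 2q extensions,
  -- ending at only q + 1 neighbours of t, which allow q + 3 walks in total.
  S[D-1]≤1 : ∀ u t → S (3 + e) u t ≤ 1
  S[D-1]≤1 u t = ≮⇒≥ λ 2≤S → <⇒≱ 4≤q (+-cancelˡ-≤ q q 3 (begin
    q + q                 ≡⟨ cong (q +_) (+-identityʳ q) ⟨
    2 * q                 ≡⟨ *-comm 2 q ⟩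
    q * 2                 ≤⟨ *-monoʳ-≤ q 2≤S ⟩
    q * S (3 + e) u t     ≤⟨ q*S≤a∙S (3 + e) u t ⟩
    (a ∙ S D) u t         ≡⟨ a∙S≡ u t ⟩
    suc q + (a ∙ B) u t   ≤⟨ +-monoʳ-≤ (suc q) a∙B≤2 ⟩
    suc q + 2             ≡⟨ +-suc q 2 ⟨
    q + 3                 ∎))
    where
    open ≤-Reasoning
    a∙B≤2 : (a ∙ B) u t ≤ 2
    a∙B≤2 = begin
      ∑ (λ w → a u w * B w t) ≤⟨ ∑-mono {n} (λ w → ≤-trans (*-monoˡ-≤ (B w t) (a≤1 u w)) (≤-reflexive (trans (+-identityʳ _) (B-sym w t)))) ⟩
      ∑ (B t)                 ≡⟨ rowB t ⟩
      2                       ∎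

  B-two : ∀ {u x y z} → 1 ≤ B u x → 1 ≤ B u y → 1 ≤ B u z → x ≢ y → x ≢ z → y ≡ z
  B-two {u} {x} {y} {z} p q r x≢y x≢z with y ≟F z
  ... | yes y≡z = y≡z
  ... | no y≢z  = contradiction
    (≤-trans (+-mono-≤ p (+-mono-≤ q r)) (≤-trans (three≤∑ (B u) x≢y x≢z y≢z) (≤-reflexive (rowB u)))) (<⇒≱ ≤-refl)

  B-double : ∀ {u x y} → 2 ≤ B u x → 1 ≤ B u y → x ≡ y
  B-double {u} {x} {y} p q with x ≟F y
  ... | yes x≡y = x≡y
  ... | no x≢y  = contradiction
    (≤-trans (+-mono-≤ p q) (≤-trans (two≤∑ (B u) x≢y) (≤-reflexive (rowB u)))) (<⇒≱ ≤-refl)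

  B≤2 : ∀ u t → B u t ≤ 2
  B≤2 u t = ≤-trans (term≤∑ (B u) t) (≤-reflexive (rowB u))

  -- B commutes with F (suc k).
  transport : ∀ {c v k x y y′} → Wk c v k x y → 1 ≤ B y y′ →
    ∃[ z ] 1 ≤ B c z × ∃[ w ] ∃[ w′ ] Wk y′ w k w′ z
  transport {c} {v} {k} {x} {y} {y′} p r
    with ∑-positive (λ z → B c z * F (suc k) z y′) (begin
      1                              ≤⟨ *-mono-≤ (Wk⇒F p) r ⟩
      F (suc k) c y * B y y′         ≤⟨ term≤∑ (λ y → F (suc k) c y * B y y′) y ⟩
      (F (suc k) ∙ B) c y′           ≡⟨ F-commutes B B-commutes (suc k) c y′ ⟩
      (B ∙ F (suc k)) c y′           ∎)
    where open ≤-Reasoning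
  ... | z , s with *-positive {B c z} s
  ... | bz , f with F⇒Wk k f
  ... | w , w′ , o = z , bz , w′ , w , rev o

  -- Walks sorted by their first step

  opaque
    unfolding P F S

    -- The walks counted by `P`, with at most `k + 1` edges instead of exactly `k + 1`.
    Q : ℕ → V → V → V → ℕ
    Q zero    u v t = P zero u v t
    Q (suc k) u v t = P (suc k) u v t + Q k u v t

    firsts : ℕ → V → V → V → ℕ
    firsts k u t v = a u v * Q k u v t

    S-first : ∀ k u t → S (suc k) u t ≡ δ u t + ∑ (firsts k u t)
    S-first zero u t = +-comm (F 1 u t) (δ u t)
    S-first (suc k) u t = begin
      F (suc (suc k)) u t + S (suc k) u t                                       ≡⟨ cong (F (suc (suc k)) u t +_) (S-first k u t) ⟩
      F (suc (suc k)) u t + (δ u t + ∑ (λ v → a u v * Q k u v t))               ≡⟨ +-assoc (F (suc (suc k)) u t) (δ u t) _ ⟨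
      F (suc (suc k)) u t + δ u t + ∑ (λ v → a u v * Q k u v t)                 ≡⟨ cong (_+ ∑ (λ v → a u v * Q k u v t)) (+-comm _ (δ u t)) ⟩
      δ u t + F (suc (suc k)) u t + ∑ (λ v → a u v * Q k u v t)                 ≡⟨ +-assoc (δ u t) _ _ ⟩
      δ u t + (F (suc (suc k)) u t + ∑ (λ v → a u v * Q k u v t))
        ≡⟨ cong (δ u t +_) (∑-distrib-+ (λ v → a u v * P (suc k) u v t) (λ v → a u v * Q k u v t)) ⟨
      δ u t + ∑ (λ v → a u v * P (suc k) u v t + a u v * Q k u v t)
        ≡⟨ cong (δ u t +_) (sum-cong-≗ (λ v → *-distribˡ-+ (a u v) (P (suc k) u v t) (Q k u v t))) ⟨
      δ u t + ∑ (λ v → a u v * Q (suc k) u v t) ∎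
      where open ≡-Reasoning

    P≤Q : ∀ {i k} → i ≤ k → ∀ u v t → P i u v t ≤ Q k u v t
    P≤Q {zero}  {zero}  _   u v t = ≤-refl
    P≤Q {i}     {suc k} i≤k u v t with m≤n⇒m<n∨m≡n i≤k
    ... | inj₁ i<sk = ≤-trans (P≤Q (s≤s⁻¹ i<sk) u v t) (m≤n+m _ _)
    ... | inj₂ refl = m≤m+n _ _

    Q≤S : ∀ k u v t → Q k u v t ≤ S k v t
    Q≤S zero    u v t = ≤-refl
    Q≤S (suc k) u v t = +-mono-≤ (subst (P (suc k) u v t ≤_) (≡sym (P-step k u v t)) (m≤n+m _ _)) (Q≤S k u v t)

    Q-positive : ∀ k {u v t} → 1 ≤ Q k u v t → ∃[ i ] i ≤ k × 1 ≤ P i u v t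
    Q-positive zero    p = 0 , z≤n , p
    Q-positive (suc k) {u} {v} {t} p with P (suc k) u v t in eq
    ... | suc _ = suc k , ≤-refl , subst (1 ≤_) (≡sym eq) (s≤s z≤n)
    ... | zero with Q-positive k p
    ...   | i , i≤k , r = i , m≤n⇒m≤1+n i≤k , r

    Wk⇒firsts : ∀ {u v i x t k} → Wk u v i x t → i < suc k → 1 ≤ firsts k u t v
    Wk⇒firsts {u} {v} {i} {x} {t} {k} p i≤k = *-mono-≤ (≤-reflexive (≡sym (~⇒a (first p))))
      (≤-trans (Wk⇒P p) (P≤Q (s≤s⁻¹ i≤k) u v t))

    firsts⇒Wk : ∀ {u v t} k → 1 ≤ firsts k u t v → ∃[ i ] i < suc k × ∃[ x ] Wk u v i x t
    firsts⇒Wk {u} {v} {t} k p with a*-positive p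
    ... | u~v , r with Q-positive k r
    ... | i , i≤k , s with P⇒Wk i u~v s
    ... | x , w = i , s≤s i≤k , x , w

    firsts≤S : ∀ k u t → ∑ (firsts k u t) ≤ S (suc k) u t
    firsts≤S k u t = ≤-trans (m≤n+m _ (δ u t)) (≤-reflexive (≡sym (S-first k u t)))

  opaque
    unfolding firsts

    -- After the first step at most D - 1 edges remain, so walks of length at most D with common
    -- ends are told apart by their first steps.
    firsts≤1 : ∀ u t v → firsts (3 + e) u t v ≤ 1
    firsts≤1 u t v = *-mono-≤ (a≤1 u v) (≤-trans (Q≤S (3 + e) u v t) (S[D-1]≤1 v t))

  -- The index of `Wk` is one less than the length: `i < 3 + e` means length at most D - 1, and
  -- `i < D` length at most D. Two different lengths or two different first steps would each
  -- contribute 2 to an entry of `S (3 + e)`.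
  short-unique : ∀ {u v v′ i j x x′ t} → Wk u v i x t → Wk u v′ j x′ t →
    i < 3 + e → j < 3 + e → i ≡ j × v ≡ v′
  short-unique {u} {v} {v′} {i} {j} {t = t} p p′ i< j< = lengths , starts
    where
    contra : 2 ≤ S (3 + e) u t → ⊥
    contra 2≤ = <⇒≱ ≤-refl (≤-trans 2≤ (S[D-1]≤1 u t))
    lengths : i ≡ j
    lengths with <-cmp i j
    ... | tri≈ _ i≡j _ = i≡j
    ... | tri< i<j _ _ = ⊥-elim (contra (≤-trans (+-mono-≤ (Wk⇒F p) (Wk⇒F p′)) (two-F≤S (s≤s i<j) j< u t)))
    ... | tri> _ _ j<i = ⊥-elim (contra (≤-trans (+-mono-≤ (Wk⇒F p′) (Wk⇒F p)) (two-F≤S (s≤s j<i) i< u t)))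
    starts : v ≡ v′
    starts with v ≟F v′
    ... | yes v≡v′ = v≡v′
    ... | no v≢v′  = ⊥-elim (contra (≤-trans (+-mono-≤ (Wk⇒firsts p i<) (Wk⇒firsts p′ j<))
                       (≤-trans (two≤∑ (firsts (2 + e) u t) v≢v′) (firsts≤S (2 + e) u t))))

  short-unique-last : ∀ {u v v′ i j x x′ t} → Wk u v i x t → Wk u v′ j x′ t →
    i < 3 + e → j < 3 + e → x ≡ x′
  short-unique-last p p′ i< j< = proj₂ (short-unique (rev p) (rev p′) i< j<)

  -- Without its first edge, a closed walk competes with the single edge from `v` back to `u`.
  no-loop : ∀ {u v i x} → Wk u v i x u → i < D → ⊥
  no-loop (nil u~u) _ = ~⇒≢ u~u refl
  no-loop (cons u~v u≢w p) (s≤s i<) = u≢w (≡sym (proj₂ (short-unique p (nil (~-sym u~v)) i< (s≤s z≤n))))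

  -- Lengths at most D - 2 and D are as good as D - 1 twice: if the first steps differ, the first
  -- edge of the longer walk is moved to the front of the shorter one.
  long-unique : ∀ {u v v′ i j x x′ t} → Wk u v i x t → Wk u v′ j x′ t →
    i < 2 + e → j < D → i ≡ j × v ≡ v′
  long-unique {v = v} {v′} {i} {j} p p′ i< j< with m<1+n⇒m<n∨m≡n j<
  ... | inj₁ j<′ = short-unique p p′ (m≤n⇒m≤1+n i<) j<′
  long-unique {v = v} {v′} p p′@(cons u~v′ u≢w p″) i< j< | inj₂ refl with v ≟F v′
  ... | no v≢v′ = ⊥-elim (u≢w (proj₂ (short-unique (cons (~-sym u~v′) (v≢v′ ∘ ≡sym) p) p″ (s≤s i<) ≤-refl)))
  long-unique (nil _)        (cons u~v′ u≢w p″) i< j< | inj₂ refl | yes refl = ⊥-elim (no-loop p″ (m≤n⇒m≤1+n ≤-refl))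
  long-unique (cons _ _ r)   (cons u~v′ u≢w p″) i< j< | inj₂ refl | yes refl =
    cong suc (proj₁ (short-unique r p″ (≤-trans (n≤1+n _) (m≤n⇒m≤1+n i<)) ≤-refl)) , refl

  two-walks⇒B : ∀ {u v v′ i j x x′ t} → Wk u v i x t → Wk u v′ j x′ t → i < D → j < D → v ≢ v′ → 1 ≤ B u t
  two-walks⇒B {u} {t = t} p p′ i< j< v≢v′ = s≤s⁻¹ (begin
    2                             ≤⟨ +-mono-≤ (Wk⇒firsts p i<) (Wk⇒firsts p′ j<) ⟩
    firsts (3 + e) u t _ + _      ≤⟨ two≤∑ (firsts (3 + e) u t) v≢v′ ⟩
    ∑ (firsts (3 + e) u t)        ≤⟨ firsts≤S (3 + e) u t ⟩
    S D u t                       ≡⟨ S≡1+B u t ⟩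
    suc (B u t)                   ∎)
    where open ≤-Reasoning

  three-walks⇒B : ∀ {u v₁ v₂ v₃ i j k x y z t} → Wk u v₁ i x t → Wk u v₂ j y t → Wk u v₃ k z t →
    i < D → j < D → k < D → v₁ ≢ v₂ → v₁ ≢ v₃ → v₂ ≢ v₃ → 2 ≤ B u t
  three-walks⇒B {u} {t = t} p₁ p₂ p₃ i< j< k< n₁₂ n₁₃ n₂₃ = s≤s⁻¹ (begin
    3                             ≤⟨ +-mono-≤ (Wk⇒firsts p₁ i<) (+-mono-≤ (Wk⇒firsts p₂ j<) (Wk⇒firsts p₃ k<)) ⟩
    firsts (3 + e) u t _ + _      ≤⟨ three≤∑ (firsts (3 + e) u t) n₁₂ n₁₃ n₂₃ ⟩
    ∑ (firsts (3 + e) u t)        ≤⟨ firsts≤S (3 + e) u t ⟩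
    S D u t                       ≡⟨ S≡1+B u t ⟩
    suc (B u t)                   ∎)
    where open ≤-Reasoning

  four-walks⇒⊥ : ∀ {u v₁ v₂ v₃ v₄ i j k l x y z w t} →
    Wk u v₁ i x t → Wk u v₂ j y t → Wk u v₃ k z t → Wk u v₄ l w t →
    i < D → j < D → k < D → l < D →
    v₁ ≢ v₂ → v₁ ≢ v₃ → v₁ ≢ v₄ → v₂ ≢ v₃ → v₂ ≢ v₄ → v₃ ≢ v₄ → ⊥
  four-walks⇒⊥ {u} {t = t} p₁ p₂ p₃ p₄ i< j< k< l< n₁₂ n₁₃ n₁₄ n₂₃ n₂₄ n₃₄ = <⇒≱ ≤-refl (begin
    4                             ≤⟨ +-mono-≤ (Wk⇒firsts p₁ i<) (+-mono-≤ (Wk⇒firsts p₂ j<) (+-mono-≤ (Wk⇒firsts p₃ k<) (Wk⇒firsts p₄ l<))) ⟩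
    firsts (3 + e) u t _ + _      ≤⟨ four≤∑ (firsts (3 + e) u t) n₁₂ n₁₃ n₁₄ n₂₃ n₂₄ n₃₄ ⟩
    ∑ (firsts (3 + e) u t)        ≤⟨ firsts≤S (3 + e) u t ⟩
    S D u t                       ≡⟨ S≡1+B u t ⟩
    suc (B u t)                   ≤⟨ s≤s (B≤2 u t) ⟩
    3                             ∎)
    where open ≤-Reasoning

  firsts≡S : ∀ {u t} → 1 ≤ B u t → ∑ (firsts (3 + e) u t) ≡ suc (B u t)
  firsts≡S {u} {t} p = by-cases (u ≟F t)
    where
    total : suc (B u t) ≡ δ u t + ∑ (firsts (3 + e) u t)
    total = trans (≡sym (S≡1+B u t)) (S-first (3 + e) u t)
    by-cases : Dec (u ≡ t) → ∑ (firsts (3 + e) u t) ≡ suc (B u t)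
    by-cases (no u≢t) = ≡sym (trans total (cong (_+ ∑ (firsts (3 + e) u t)) (δ-off u≢t)))
    by-cases (yes refl) = ⊥-elim (no-loop (proj₂ (proj₂ (proj₂ loop))) (proj₁ (proj₂ loop)))
      where
      start : ∃[ v ] 1 ≤ firsts (3 + e) u u v
      start = ∑-positive (firsts (3 + e) u u) (≤-trans p (≤-reflexive (suc-injective
          (trans total (cong (_+ ∑ (firsts (3 + e) u u)) (δ-diag u))))))
      loop : ∃[ i ] i < D × ∃[ x ] Wk u (proj₁ start) i x u
      loop = firsts⇒Wk (3 + e) (proj₂ start)

  Other : V → V → V → Set
  Other u t v = ∃[ v′ ] v ≢ v′ × ∃[ i ] i < D × ∃[ x ] Wk u v′ i x t

  other-walk : ∀ {u t} → 1 ≤ B u t → ∀ v → Other u t v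
  other-walk {u} {t} p v with another-term (firsts (3 + e) u t) v
      (≤-trans (s≤s (firsts≤1 u t v)) (≤-trans (s≤s p) (≤-reflexive (≡sym (firsts≡S p)))))
  ... | v′ , v≢v′ , f = v′ , v≢v′ , firsts⇒Wk (3 + e) f

  third-walk : ∀ {u t} → 2 ≤ B u t → ∀ v v′ → ∃[ v″ ] v ≢ v″ × v′ ≢ v″ × ∃[ i ] i < D × ∃[ x ] Wk u v″ i x t
  third-walk {u} {t} p v v′ with third-term (firsts (3 + e) u t) v v′
      (≤-trans (s≤s (+-mono-≤ (firsts≤1 u t v) (firsts≤1 u t v′)))
        (≤-trans (s≤s p) (≤-reflexive (≡sym (firsts≡S (≤-trans (s≤s z≤n) p))))))
  ... | v″ , n₁ , n₂ , f = v″ , n₁ , n₂ , firsts⇒Wk (3 + e) f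

  B⇒long : ∀ {u t v i x} → 1 ≤ B u t → Wk u v i x t → i < D → 2 + e ≤ i
  B⇒long {v = v} {i} p w i< with i <? 2 + e
  ... | no i≮ = ≮⇒≥ i≮
  ... | yes i<′ with other-walk p v
  ... | v′ , v≢v′ , j , j< , x′ , w′ = ⊥-elim (v≢v′ (proj₂ (long-unique w w′ i<′ j<)))

  between : ∀ {i} → 2 + e ≤ i → i < D → i ≡ 2 + e ⊎ i ≡ 3 + e
  between {i} l u with m<1+n⇒m<n∨m≡n u
  ... | inj₂ eq = inj₂ eq
  ... | inj₁ i< = inj₁ (≤-antisym (s≤s⁻¹ i<) l)

  -- The two walks form a closed walk of length 2D or 2D - 1; two of length D - 1 would coincide.
  data Repeat (u t : V) : Set where
    even : ∀ {v v′ x x′} → v ≢ v′ → Wk u v (3 + e) x t → Wk u v′ (3 + e) x′ t → Repeat u t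
    odd  : ∀ {v v′ x x′} → v ≢ v′ → Wk u v (3 + e) x t → Wk u v′ (2 + e) x′ t → Repeat u t

  repeat : ∀ {u t} → 1 ≤ B u t → Repeat u t
  -- No walk from `u` has `u` as its second vertex, so this excludes nothing and merely provides a
  -- first walk.
  repeat {u} {t} p with other-walk p u
  ... | v , _ , i , i< , x , w with other-walk p v
  ... | v′ , v≢v′ , j , j< , x′ , w′ with between (B⇒long p w i<) i< | between (B⇒long p w′ j<) j<
  ... | inj₁ refl | inj₁ refl = ⊥-elim (v≢v′ (proj₂ (short-unique w w′ ≤-refl ≤-refl)))
  ... | inj₁ refl | inj₂ refl = odd (v≢v′ ∘ ≡sym) w′ w
  ... | inj₂ refl | inj₁ refl = odd v≢v′ w w′
  ... | inj₂ refl | inj₂ refl = even v≢v′ w w′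

  -- If two distinct walks end with the same edge, then deleting it leaves two
  -- short walks.
  lasts≢ : ∀ {u v v′ i j x x′ t} → Wk u v i x t → Wk u v′ j x′ t → i < D → j < D → v ≢ v′ → x ≢ x′
  lasts≢ {u} {v} {v′} {i} {j} p p′ i< j< v≢v′ refl with rev p | rev p′
  ... | nil _ | nil _ = v≢v′ refl
  ... | nil _ | cons _ _ r′ = no-loop r′ (≤-trans (n≤1+n _) j<)
  ... | cons _ _ r | nil _ = no-loop r (≤-trans (n≤1+n _) i<)
  ... | cons _ _ r | cons _ _ r′ = v≢v′ (short-unique-last r r′ (s≤s⁻¹ i<) (s≤s⁻¹ j<))

  lengths≢⇒B : ∀ {u v v′ i j x x′ t} → Wk u v i x t → Wk u v′ j x′ t → i < D → j < D → i ≢ j → 1 ≤ B u t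
  lengths≢⇒B {u} {i = i} {j} {t = t} p p′ i< j< i≢j = s≤s⁻¹ (subst (2 ≤_) (S≡1+B u t) two)
    where
    two : 2 ≤ S D u t
    two with <-cmp i j
    ... | tri≈ _ i≡j _ = contradiction i≡j i≢j
    ... | tri< i<j _ _ = ≤-trans (+-mono-≤ (Wk⇒F p) (Wk⇒F p′)) (two-F≤S (s≤s i<j) j< u t)
    ... | tri> _ _ j<i = ≤-trans (+-mono-≤ (Wk⇒F p′) (Wk⇒F p)) (two-F≤S (s≤s j<i) i< u t)

  -- Sets of vertices that contain the walks to their repeats

  module Region (H : V → Set) where

    Inside : ∀ {u v k x y} → Wk u v k x y → Set
    Inside {u} {v} (nil _)      = H u × H v
    Inside {u}     (cons _ _ p) = H u × Inside p

    inside-start : ∀ {u v k x y} (p : Wk u v k x y) → Inside p → H u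
    inside-start (nil _)      = proj₁
    inside-start (cons _ _ _) = proj₁

    inside-second : ∀ {u v k x y} (p : Wk u v k x y) → Inside p → H v
    inside-second (nil _)      = proj₂
    inside-second (cons _ _ p) = inside-start p ∘ proj₂

    inside-end : ∀ {u v k x y} (p : Wk u v k x y) → Inside p → H y
    inside-end (nil _)      = proj₂
    inside-end (cons _ _ p) = inside-end p ∘ proj₂

    inside-penultimate : ∀ {u v k x y} (p : Wk u v k x y) → Inside p → H x
    inside-penultimate (nil _)      = proj₁
    inside-penultimate (cons _ _ p) = inside-penultimate p ∘ proj₂

    inside-snoc : ∀ {u v k x y z} (p : Wk u v k x y) (x≢z : x ≢ z) (y~z : y ~ z) →
      Inside p → H z → Inside (snoc p x≢z y~z)
    inside-snoc (nil _)      _   _   (hu , hv) hz = hu , hv , hz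
    inside-snoc (cons _ _ p) x≢z y~z (hu , hp) hz = hu , inside-snoc p x≢z y~z hp hz

    inside-unsnoc : ∀ {u v k x y z} (p : Wk u v k x y) (x≢z : x ≢ z) (y~z : y ~ z) →
      Inside (snoc p x≢z y~z) → Inside p
    inside-unsnoc (nil _)      _   _   (hu , hv , _) = hu , hv
    inside-unsnoc (cons _ _ p) x≢z y~z (hu , hp)     = hu , inside-unsnoc p x≢z y~z hp

    inside-rev : ∀ {u v k x y} (p : Wk u v k x y) → Inside p → Inside (rev p)
    inside-rev (nil _)      (hu , hv) = hv , hu
    inside-rev (cons _ _ p) (hu , hp) = inside-snoc (rev p) _ _ (inside-rev p hp) hu

    inside-join : ∀ {u v i x y z j s t} (p : Wk u v i x y) (x≢z : x ≢ z) (r : Wk y z j s t) →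
      Inside p → Inside r → Inside (join p x≢z r)
    inside-join (nil _)      _   r (hu , _)  hr = hu , hr
    inside-join (cons _ _ p) x≢z r (hu , hp) hr = hu , inside-join p x≢z r hp hr

    Saturated : V → Set
    Saturated z = ∀ {v i x t} (p : Wk z v i x t) → i < D → 1 ≤ B z t → Inside p

    short-inside : ∀ {u v v′ i j x x′ t} (p : Wk u v i x t) (r : Wk u v′ j x′ t) →
      i < 3 + e → j < 3 + e → Inside p → Inside r
    short-inside p r i< j< hp with short-unique p r i< j<
    short-inside (nil _)      (nil _)      _  _  hp        | refl , refl = hp
    short-inside (cons _ _ p) (cons _ _ r) i< j< (hu , hp) | refl , refl =
      hu , short-inside p r (≤-trans (n≤1+n _) i<) (≤-trans (n≤1+n _) j<) hp

    same-first-inside : ∀ {u v i j x x′ t} (p : Wk u v i x t) (r : Wk u v j x′ t) →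
      i < D → j < D → Inside p → Inside r
    same-first-inside (nil _)      (nil _)      _  _  hp        = hp
    same-first-inside (nil _)      (cons _ _ r) _  j< _         = ⊥-elim (no-loop r (≤-trans (n≤1+n _) j<))
    same-first-inside (cons _ _ p) (nil _)      i< _  _         = ⊥-elim (no-loop p (≤-trans (n≤1+n _) i<))
    same-first-inside (cons _ _ p) (cons _ _ r) i< j< (hu , hp) =
      hu , short-inside p r (s≤s⁻¹ i<) (s≤s⁻¹ j<) hp

    record Pair (z t : V) : Set where
      constructor pair
      field
        {v₁ v₂ x₁ x₂} : V
        {k₁ k₂} : ℕ
        p₁ : Wk z v₁ k₁ x₁ t
        p₂ : Wk z v₂ k₂ x₂ t
        k₁< : k₁ < D
        k₂< : k₂ < D
        v₁≢v₂ : v₁ ≢ v₂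
        h₁ : Inside p₁
        h₂ : Inside p₂

    pair⇒B : ∀ {z t} → Pair z t → 1 ≤ B z t
    pair⇒B (pair p₁ p₂ k₁< k₂< v₁≢v₂ _ _) = two-walks⇒B p₁ p₂ k₁< k₂< v₁≢v₂

    -- A walk other than the given two would make `t` a double repeat, which leaves no room for `t′`
    -- in a row of sum 2.
    pair-inside : ∀ {z t t′ v i x} → Pair z t → 1 ≤ B z t′ → t ≢ t′ → (p : Wk z v i x t) → i < D → Inside p
    pair-inside {v = v} (pair {v₁} {v₂} p₁ p₂ k₁< k₂< v₁≢v₂ h₁ h₂) b t≢t′ p i< with v ≟F v₁ | v ≟F v₂
    ... | yes refl | _        = same-first-inside p₁ p k₁< i< h₁
    ... | no _     | yes refl = same-first-inside p₂ p k₂< i< h₂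
    ... | no v≢v₁  | no v≢v₂  = ⊥-elim (t≢t′ (B-double
            (three-walks⇒B p p₁ p₂ i< k₁< k₂< v≢v₁ v≢v₂ v₁≢v₂) b))

    pairs⇒saturated : ∀ {z t t′} → t ≢ t′ → Pair z t → Pair z t′ → Saturated z
    pairs⇒saturated {t = t} {t′} t≢t′ P P′ {t = s} p i< b with s ≟F t
    ... | yes refl = pair-inside P (pair⇒B P′) t≢t′ p i<
    ... | no s≢t with B-two (pair⇒B P) b (pair⇒B P′) (s≢t ∘ ≡sym) t≢t′
    ...   | refl = pair-inside P′ (pair⇒B P) s≢t p i<

    triple⇒saturated : ∀ {z t v₁ v₂ v₃ x₁ x₂ x₃ k₁ k₂ k₃}
      (p₁ : Wk z v₁ k₁ x₁ t) (p₂ : Wk z v₂ k₂ x₂ t) (p₃ : Wk z v₃ k₃ x₃ t) →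
      k₁ < D → k₂ < D → k₃ < D → v₁ ≢ v₂ → v₁ ≢ v₃ → v₂ ≢ v₃ →
      Inside p₁ → Inside p₂ → Inside p₃ → Saturated z
    triple⇒saturated {v₁ = v₁} {v₂} {v₃} p₁ p₂ p₃ k₁< k₂< k₃< n₁₂ n₁₃ n₂₃ h₁ h₂ h₃ {v} p i< b
      with B-double (three-walks⇒B p₁ p₂ p₃ k₁< k₂< k₃< n₁₂ n₁₃ n₂₃) b
    ... | refl with v ≟F v₁ | v ≟F v₂ | v ≟F v₃
    ...   | yes refl | _        | _        = same-first-inside p₁ p k₁< i< h₁
    ...   | no _     | yes refl | _        = same-first-inside p₂ p k₂< i< h₂
    ...   | no _     | no _     | yes refl = same-first-inside p₃ p k₃< i< h₃
    ...   | no n₁    | no n₂    | no n₃    =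
            ⊥-elim (four-walks⇒⊥ p p₁ p₂ p₃ i< k₁< k₂< k₃< n₁ n₂ n₃ n₁₂ n₁₃ n₂₃)

    -- The two cases to which the argument is applied: on a cycle of length 2D - 1 the vertices `s`
    -- and `x` are adjacent, while on three walks of length D they have a common neighbour, namely
    -- an end of the walks.
    record Hub (s x : V) : Set where
      constructor hub
      field
        {h}  : V
        h∈H  : H h
        h~x  : h ~ x
        link : h ≡ s ⊎ (h ~ s × s ≢ x)

    module _ (saturated : ∀ {z} → H z → Saturated z) where

      closed : ∀ {z t} → H z → 1 ≤ B z t → H t
      closed {z} z∈H b with other-walk b z
      ... | _ , _ , _ , i< , _ , p = inside-end p (saturated z∈H p i< b)

      -- A walk from h that leaves H is the only walk of length at most D
      -- between its ends.
      separate : ∀ {h v k c x v′ j c′ t} → H h → (g : Wk h v k c t) → ¬ Inside g → k < D → v ≢ x → h ~ x →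
        Wk x v′ j c′ t → suc j < D → j ≤ k → ⊥
      separate {h} {v′ = v′} h∈H g out k< v≢x h~x w j< j≤k with h ≟F v′
      ... | no h≢v′ = out (saturated h∈H g k< (two-walks⇒B g (cons h~x h≢v′ w) k< j< v≢x))
      ... | yes refl with w
      ...   | nil _ = no-loop g k<
      ...   | cons _ _ w′ = out (saturated h∈H g k<
                (lengths≢⇒B g w′ k< (≤-trans (n≤1+n _) (≤-trans (n≤1+n _) j<)) λ { refl → <⇒≱ j≤k ≤-refl }))

      -- If the hub is a common neighbour, `g` is first prolonged by the edge from `h` to `s`; hence
      -- the stricter bound `suc k < D`.
      separate-hub : ∀ {s x v k c v′ j c′ t} → Hub s x → H x → ¬ H v → Wk s v k c t → suc k < D →
        Wk x v′ j c′ t → suc j < D → j ≤ k → ⊥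
      separate-hub (hub h∈H h~x (inj₁ refl)) x∈H v∉H g k< =
        separate h∈H g (v∉H ∘ inside-second g) (≤-trans (n≤1+n _) k<) (λ { refl → v∉H x∈H }) h~x
      separate-hub (hub h∈H h~x (inj₂ (h~s , s≢x))) x∈H v∉H g k< w j< j≤k =
        separate h∈H (cons h~s (λ { refl → v∉H h∈H }) g) (v∉H ∘ inside-second g ∘ proj₂) k< s≢x h~x w j< (m≤n⇒m≤1+n j≤k)

      -- x₋₁, x₀, x₁, x₂ are consecutive repeats in H and y is a neighbour of x₀
      -- outside H.  Then y has repeats y₁ ~ x₁ and y₋₁ ~ x₋₁, and the vertex c at
      -- distance 2 from y on the cycle through y and y₁ has, apart from its
      -- opposite vertex c*, a repeat z at distance 2 from y₋₁ and D − 1 from x₂.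
      -- Walking from z through y₋₁ and x₋₁ to x₂ and straight back to z gives a
      -- closed walk of length 2D that enters and leaves H.
      module _
        {x₀ x₁ x₋₁ x₂ h₂ l y : V} (x₀∈H : H x₀)
        (x₀↔x₁ : 1 ≤ B x₀ x₁) (x₀↔x₋₁ : 1 ≤ B x₀ x₋₁) (x₁↔x₂ : 1 ≤ B x₁ x₂)
        (hub₁ : Hub x₁ x₋₁) (hub₀ : Hub x₀ x₂)
        (segment : Wk x₂ h₂ (suc e) l x₋₁) (segment∈H : Inside segment)
        (x₀~y : x₀ ~ y) (y∉H : ¬ H y) where

        private
          x₁∈H : H x₁
          x₁∈H = closed x₀∈H x₀↔x₁

          x₋₁∈H : H x₋₁
          x₋₁∈H = closed x₀∈H x₀↔x₋₁

          x₂∈H : H x₂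
          x₂∈H = closed x₁∈H x₁↔x₂

          outside : ∀ {t} → 1 ≤ B y t → ¬ H t
          outside b t∈H = y∉H (closed t∈H (B-flip b))

          module Ends {y₁ y₋₁ : V} (y↔y₁ : 1 ≤ B y y₁) (y↔y₋₁ : 1 ≤ B y y₋₁)
            (x₁~y₁ : x₁ ~ y₁) (x₋₁~y₋₁ : x₋₁ ~ y₋₁) where

            y₁∉H : ¬ H y₁
            y₁∉H = outside y↔y₁

            y₋₁∉H : ¬ H y₋₁
            y₋₁∉H = outside y↔y₋₁

            y₁≢y₋₁ : y₁ ≢ y₋₁
            y₁≢y₋₁ refl = separate-hub hub₁ x₋₁∈H y₁∉H (nil x₁~y₁) (s≤s (s≤s z≤n)) (nil x₋₁~y₋₁) (s≤s (s≤s z≤n)) z≤n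

            y₁≁y₋₁ : ¬ y₁ ~ y₋₁
            y₁≁y₋₁ y₁~y₋₁ = separate-hub hub₁ x₋₁∈H y₁∉H (cons x₁~y₁ (λ { refl → y₋₁∉H x₁∈H }) (nil y₁~y₋₁))
              (s≤s (s≤s (s≤s z≤n))) (nil x₋₁~y₋₁) (s≤s (s≤s z≤n)) z≤n

            -- Otherwise the walk from `y` to `x₁` could be preceded by `x₀`, giving a walk between
            -- repeats that leaves `H`; or it returns to `x₀` at once, and then joins the repeats
            -- `x₀` and `x₁` in D - 2 steps.
            last≢x₁ : ∀ {v x} → Wk y v (3 + e) x y₁ → x ≢ x₁
            last≢x₁ {v} p refl with rev p
            ... | cons _ _ r with x₀ ≟F v
            ...   | no x₀≢v = y∉H (inside-second walk (saturated x₀∈H walk ≤-refl x₀↔x₁))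
              where
              walk : Wk x₀ y (3 + e) _ x₁
              walk = cons x₀~y x₀≢v (rev r)
            ...   | yes refl with rev r
            ...     | cons {w = w} _ _ r′ with other-walk x₀↔x₁ w
            ...       | w′ , w≢w′ , i , i< , _ , s = w≢w′ (proj₂ (long-unique r′ s ≤-refl i<))

            first≢x₀ : ∀ {v x} → Wk y v (3 + e) x y₁ → v ≢ x₀
            first≢x₀ p@(cons _ _ r) refl =
              y₁∉H (inside-penultimate walk (saturated x₀∈H walk ≤-refl x₀↔x₁))
              where
              walk : Wk x₀ _ (3 + e) y₁ x₁
              walk = snoc r (last≢x₁ p) (~-sym x₁~y₁)

            impossible-even : ∀ {v v′ x x′} → v ≢ v′ → Wk y v (3 + e) x y₁ → Wk y v′ (3 + e) x′ y₁ → ⊥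
            impossible-even {v} {v′} {x} {x′} v≢v′ p@(cons {w = c} y~v y≢c (cons {w = c′} v~c v≢c′ p₂)) p′ with rev p′
            ... | cons y₁~x′ y₁≢c* (cons {v = c*} x′~c* _ r) = final
              where
              x≢x′ : x ≢ x′
              x≢x′ = lasts≢ p p′ ≤-refl ≤-refl v≢v′

              c→y : Wk c v 1 v y
              c→y = cons (~-sym v~c) (y≢c ∘ ≡sym) (nil (~-sym y~v))

              -- Two steps back to `y` and D - 2 along `p′`, or D - 2 steps along `p` to `y₁` and
              -- two more against `p′`.
              c↔c* : 1 ≤ B c c*
              c↔c* = two-walks⇒B (cons (~-sym v~c) (y≢c ∘ ≡sym) (cons (~-sym y~v) v≢v′ (rev r)))
                (snoc (snoc p₂ x≢x′ y₁~x′) y₁≢c* x′~c*) ≤-refl ≤-refl v≢c′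

              -- The walk of length 3 from `x₁` through `y₁` to `c*` leaves `H`, which forbids a
              -- walk from `x₋₁` to `c*` that is not longer.
              not-c*₂ : ∀ {w w′ j} → j ≤ 2 → ¬ Wk x₋₁ w j w′ c*
              not-c*₂ j≤2 w = separate-hub hub₁ x₋₁∈H y₁∉H
                (cons x₁~y₁ (last≢x₁ p′ ∘ ≡sym) (cons y₁~x′ y₁≢c* (nil x′~c*))) (s≤s (s≤s (s≤s (s≤s z≤n))))
                w (s≤s (s≤s (≤-trans j≤2 (s≤s (s≤s z≤n))))) j≤2

              not-c*₁ : ∀ {w w′} → ¬ Wk y₋₁ w 1 w′ c*
              not-c*₁ {w} s@(cons _ _ (nil w~c*)) with x₋₁ ≟F w
              ... | yes refl  = not-c*₂ z≤n (nil w~c*)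
              ... | no x₋₁≢w = not-c*₂ ≤-refl (cons x₋₁~y₋₁ x₋₁≢w s)

              not-c*₃ : ∀ {w w′} → ¬ Wk x₂ w (2 + e) w′ c*
              not-c*₃ w = separate-hub hub₀ x₂∈H y∉H (cons x₀~y (first≢x₀ p′ ∘ ≡sym) (rev r)) ≤-refl w ≤-refl ≤-refl

              other : ∀ {z z′} → 1 ≤ B c z → 1 ≤ B c z′ → c* ≢ z → c* ≢ z′ → z ≡ z′
              other = B-two c↔c*

              -- From the second vertex of the segment, the walk through `x₋₁`, `y₋₁` and `m` to `z`
              -- has length D and leaves `H`, while `x₂` reaches `z` in D - 1 steps. The walk of
              -- length 3 from `x₋₁` ensures that `m` is not `x₋₁`, which would put `z` next to
              -- `x₋₁`.
              conclude : ∀ {z m m′ w w′ s s′} (p : Wk x₂ h₂ (suc e) l x₋₁) → Inside p →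
                Wk y₋₁ m 1 m′ z → Wk x₋₁ w 2 w′ z → Wk x₂ s (2 + e) s′ z → ⊥
              conclude {m = m} (cons x₂~h₂ x₂≢h₃ seg) (_ , seg∈H) (cons y₋₁~m y₋₁≢z (nil m~z)) w₂ w₃ =
                separate (inside-start seg seg∈H) (snoc (snoc turn x₋₁≢m y₋₁~m) y₋₁≢z m~z)
                  (y₋₁∉H ∘ inside-end turn ∘ inside-unsnoc turn _ _ ∘ inside-unsnoc (snoc turn x₋₁≢m y₋₁~m) _ _)
                  ≤-refl (x₂≢h₃ ∘ ≡sym) (~-sym x₂~h₂) w₃ ≤-refl (n≤1+n _)
                where
                x₋₁≢m : x₋₁ ≢ m
                x₋₁≢m refl with () ← proj₁ (short-unique (nil m~z) w₂ (s≤s z≤n) (s≤s (s≤s (s≤s z≤n))))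
                turn : Wk h₂ _ (suc e) x₋₁ y₋₁
                turn = snoc seg (λ { refl → y₋₁∉H (inside-penultimate seg seg∈H) }) x₋₁~y₋₁

              Moved : V → ℕ → Set
              Moved x k = ∃[ z ] 1 ≤ B c z × ∃[ w ] ∃[ w′ ] Wk x w k w′ z

              identify : Moved y₋₁ 1 → Moved x₋₁ 2 → Moved x₂ (2 + e) → ⊥
              identify (z₁ , b₁ , _ , _ , w₁) (z₂ , b₂ , _ , _ , w₂) (z₃ , b₃ , _ , _ , w₃) =
                conclude segment segment∈H w₁
                  (subst (Wk x₋₁ _ 2 _) (≡sym (other b₁ b₂ (λ { refl → not-c*₁ w₁ }) (λ { refl → not-c*₂ ≤-refl w₂ }))) w₂)
                  (subst (Wk x₂ _ (2 + e) _) (≡sym (other b₁ b₃ (λ { refl → not-c*₁ w₁ }) (λ { refl → not-c*₃ w₃ }))) w₃)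

              final : ⊥
              -- The walks from `c` have lengths 2, 3 and D - 1: back to `y`, one step further to
              -- `x₀`, and forward through `y₁` to `x₁`.
              final = identify (transport c→y y↔y₋₁)
                (transport (snoc c→y (first≢x₀ p) (~-sym x₀~y)) x₀↔x₋₁)
                (transport (snoc p₂ (last≢x₁ p) (~-sym x₁~y₁)) x₁↔x₂)

            -- The two repeats of `y` on a cycle of length 2D - 1 are adjacent, whereas `y₁` and
            -- `y₋₁` are not.
            impossible-odd : ∀ {v v′ x x′} → v ≢ v′ → Wk y v (3 + e) x y₁ → Wk y v′ (2 + e) x′ y₁ → ⊥
            impossible-odd {v} {v′} {x} {x′} v≢v′ p p′ = y₁≁y₋₁ (subst (y₁ ~_) (≡sym y₋₁≡x) (~-sym (last p)))
              where
              y↔x : 1 ≤ B y x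
              y↔x with rev p
              ... | cons _ _ r = two-walks⇒B (rev r) (snoc p′ (lasts≢ p′ p (n≤1+n _) ≤-refl (v≢v′ ∘ ≡sym)) (~-sym (last p)))
                (n≤1+n _) ≤-refl v≢v′
              y₋₁≡x : y₋₁ ≡ x
              y₋₁≡x = B-two y↔y₁ y↔y₋₁ y↔x y₁≢y₋₁ (~⇒≢ (~-sym (last p)))

        impossible : ⊥
        impossible = start (transport (nil (~-sym x₀~y)) x₀↔x₁) (transport (nil (~-sym x₀~y)) x₀↔x₋₁)
          where
          Moved : V → Set
          Moved x = ∃[ z ] 1 ≤ B y z × ∃[ w ] ∃[ w′ ] Wk x w 0 w′ z
          start : Moved x₁ → Moved x₋₁ → ⊥
          start (y₁ , y↔y₁ , _ , _ , nil x₁~y₁) (y₋₁ , y↔y₋₁ , _ , _ , nil x₋₁~y₋₁) = by-parity (repeat y↔y₁)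
            where
            by-parity : Repeat y y₁ → ⊥
            by-parity (even v≢v′ p p′) = Ends.impossible-even y↔y₁ y↔y₋₁ x₁~y₁ x₋₁~y₋₁ v≢v′ p p′
            by-parity (odd  v≢v′ p p′) = Ends.impossible-odd y↔y₁ y↔y₋₁ x₁~y₁ x₋₁~y₋₁ v≢v′ p p′

  -- Cycles of length 2D − 1

  degree>2 : ∀ v u w → a v u + a v w < ∑ (a v)
  degree>2 v u w = ≤-trans (s≤s (+-mono-≤ (a≤1 v u) (a≤1 v w)))
    (≤-trans (s≤s (≤-trans (s≤s (s≤s z≤n)) 4≤q)) (≤-reflexive (≡sym (regular v))))

  M : ℕ
  M = (3 + e) + D

  M′ : M ≡ D + (3 + e)
  M′ = +-comm (3 + e) D

  module _ (H : V → Set) where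

    open Region H

    inside-segment : ∀ {m} (C : Cycle m) → (∀ i → H (at C i)) → ∀ k → Inside (segment C k)
    inside-segment C on zero    = on 0 , on 1
    inside-segment C on (suc k) = inside-snoc (segment C k) _ _ (inside-segment C on k) (on (suc (suc k)))

    -- Both vertices farthest from the start are reached by D steps one way round and D - 1 the
    -- other way.
    odd-pairs : (C : Cycle M) → (∀ i → H (at C i)) → Pair (at C 0) (at C D) × Pair (at C 0) (at C (3 + e))
    odd-pairs C on =
        pair (segment C (3 + e)) back₁ ≤-refl (n≤1+n _) (turn (2 + e + D) refl)
          (inside-segment C on (3 + e))
          (inside-subst z≡ (rev half₁) (inside-rev half₁ (inside-segment (shift D C) (on ∘ (_+ D)) (2 + e))))
      , pair (segment C (2 + e)) back₂ (n≤1+n _) ≤-refl (turn (3 + e + (3 + e)) (≡sym M′))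
          (inside-segment C on (2 + e))
          (inside-subst z′≡ (rev half₂) (inside-rev half₂ (inside-segment (shift (3 + e) C) (on ∘ (_+ (3 + e))) (3 + e))))
      where
      b b′ : V
      b  = at C (2 + e + D)
      b′ = at C (3 + e + (3 + e))
      half₁ = segment (shift D C) (2 + e)
      half₂ = segment (shift (3 + e) C) (3 + e)
      z≡ : at C M ≡ at C 0
      z≡ = periodic C 0
      z′≡ : at C (D + (3 + e)) ≡ at C 0
      z′≡ = trans (cong (at C) (≡sym M′)) z≡
      back₁ : Wk (at C 0) b (2 + e) (at C (1 + D)) (at C D)
      back₁ = subst (λ z → Wk z b (2 + e) (at C (1 + D)) (at C D)) z≡ (rev half₁)
      back₂ : Wk (at C 0) b′ (3 + e) (at C D) (at C (3 + e))
      back₂ = subst (λ z → Wk z b′ (3 + e) (at C D) (at C (3 + e))) z′≡ (rev half₂)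
      turn : ∀ i → suc i ≡ M → at C 1 ≢ at C i
      turn i eq v≡ = turning C i (trans (≡sym v≡) (≡sym (trans (cong (at C ∘ suc) eq) (periodic C 1))))
      inside-subst : ∀ {z z′ v k x t} (eq : z ≡ z′) (p : Wk z v k x t) → Inside p →
        Inside (subst (λ z → Wk z v k x t) eq p)
      inside-subst refl p h = h

  inside-uncons : ∀ (H : V → Set) {u v k x y} (p : Wk u v (suc k) x y) → Region.Inside H p →
    ∃[ w ] ∃ λ (r : Wk v w k x y) → Region.Inside H r
  inside-uncons H (cons _ _ r) (_ , h) = _ , r , h

  module _ (C : Cycle M) where

    OnCycle : V → Set
    OnCycle z = ∃[ i ] at C i ≡ z

    open Region OnCycle

    on-saturated : ∀ {z} → OnCycle z → Saturated z
    on-saturated (i , refl) with odd-pairs OnCycle (shift i C) (λ j → j + i , refl)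
    ... | P , P′ = pairs⇒saturated (~⇒≢ (~-sym (adjacent C (3 + e + i)))) P P′

    -- A neighbour on the cycle would also be reached along the cycle in at most D - 1 steps, going
    -- the shorter way, and that walk would have to start with the edge to `y`.
    off : ∀ {y} → at C 0 ~ y → at C 1 ≢ y → at C (2 + e + D) ≢ y → ¬ OnCycle y
    off {y} z~y next≢y previous≢y (i , refl) with reduce C i
    ... | zero , _ , eq = ~⇒≢ z~y eq
    ... | suc j , j< , eq with j <? 3 + e
    ...   | yes j<′ = next≢y (proj₂ (short-unique (subst (Wk _ _ j _) eq (segment C j)) (nil z~y) j<′ (s≤s z≤n)))
    ...   | no j≮ with m≤n⇒∃[o]m+o≡n j<
    ...     | m , eq′ = previous≢y (trans (cong (at C) (suc-injective (≡sym 1+m+j)))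
              (proj₂ (short-unique (subst₂ (λ s t → Wk s (at C (m + suc j)) m (at C (1 + suc j)) t)
                (trans (cong (at C) 1+m+j) (periodic C 0)) eq (rev (segment (shift (suc j) C) m))) (nil z~y) m< (s≤s z≤n))))
      where
      1+m+j : suc m + suc j ≡ M
      1+m+j = trans (+-comm (suc m) (suc j)) (trans (+-suc (suc j) m) eq′)
      m< : suc m ≤ 3 + e
      m< = +-cancelʳ-≤ D (suc m) (3 + e) (≤-trans (+-monoʳ-≤ (suc m) (s≤s (≮⇒≥ j≮))) (≤-reflexive 1+m+j))

    no-odd-cycle : ⊥
    no-odd-cycle with odd-pairs OnCycle C (λ i → i , refl) | odd-pairs OnCycle (shift 1 C) (λ i → i + 1 , refl)
                    | third-term (a (at C 0)) (at C 1) (at C (2 + e + D))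
                        (degree>2 _ _ _)
                    | inside-uncons OnCycle (segment C (2 + e)) (inside-segment OnCycle C (λ i → i , refl) (2 + e))
    ... | P , P′ | _ , P″ | y , n₁ , n₂ , z~y | _ , r , r∈H =
      -- Here x₀, x₁, x₋₁, x₂ are the vertices with indices 0, D, D - 1 and 1.
      impossible on-saturated (0 , refl) (pair⇒B P) (pair⇒B P′)
        (B-flip (subst (λ i → 1 ≤ B (at C 1) (at C i)) (+-comm (3 + e) 1) (pair⇒B P″)))
        (hub (D , refl) (~-sym (adjacent C (3 + e))) (inj₁ refl)) (hub (0 , refl) (adjacent C 0) (inj₁ refl))
        r r∈H (a⇒~ z~y) (off (a⇒~ z~y) n₁ n₂)

  no-odd-repeat : ∀ {u v v′ x x′ t} → v ≢ v′ → Wk u v (3 + e) x t → Wk u v′ (2 + e) x′ t → ⊥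
  no-odd-repeat v≢v′ p p′ = no-odd-cycle (subst Cycle length≡ (closed⇒cycle
      (snoc (join p (lasts≢ p p′ ≤-refl (n≤1+n _) v≢v′) (rev p′)) (v≢v′ ∘ ≡sym) (first p))))
    where
    length≡ : 2 + (3 + e + (2 + e)) ≡ M
    length≡ = ≡sym (trans (+-suc (3 + e) (3 + e)) (cong suc (+-suc (3 + e) (2 + e))))

  -- Three walks of length D with common ends

  B⇒even : ∀ {u t v i x} → 1 ≤ B u t → Wk u v i x t → i < D → i ≡ 3 + e
  B⇒even {v = v} b p i< with other-walk b v
  ... | v′ , v≢v′ , j , j< , _ , p′ with between (B⇒long b p i<) i< | between (B⇒long b p′ j<) j<
  ...   | inj₂ eq   | _         = eq
  ...   | inj₁ refl | inj₁ refl = ⊥-elim (v≢v′ (proj₂ (short-unique p p′ ≤-refl ≤-refl)))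
  ...   | inj₁ refl | inj₂ refl = ⊥-elim (no-odd-repeat (v≢v′ ∘ ≡sym) p′ p)

  On : ∀ {u v k x y} → Wk u v k x y → V → Set
  On {u} {v} (nil _)      z = z ≡ u ⊎ z ≡ v
  On {u}     (cons _ _ p) z = z ≡ u ⊎ On p z

  on-start : ∀ {u v k x y} (p : Wk u v k x y) → On p u
  on-start (nil _)      = inj₁ refl
  on-start (cons _ _ _) = inj₁ refl

  on-end : ∀ {u v k x y} (p : Wk u v k x y) → On p y
  on-end (nil _)      = inj₂ refl
  on-end (cons _ _ p) = inj₂ (on-end p)

  on⇒inside : ∀ (H : V → Set) {u v k x y} (p : Wk u v k x y) → (∀ {z} → On p z → H z) → Region.Inside H p
  on⇒inside H (nil _)      on = on (inj₁ refl) , on (inj₂ refl)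
  on⇒inside H (cons _ _ p) on = on (inj₁ refl) , on⇒inside H p (on ∘ inj₂)

  -- The neighbours `c` and `d` of `z` on the walk are kept distinct because walks continued in the
  -- two directions must differ in their first step to form a `Pair`.
  record Cut {u v k x y} (p : Wk u v k x y) (z : V) (i j : ℕ) : Set where
    constructor cut
    field
      {c d}  : V
      before : Wk u v i c z
      after  : Wk z d j x y
      c≢d    : c ≢ d
      onˡ    : ∀ {w} → On before w → On p w
      onʳ    : ∀ {w} → On after w → On p w

  cut-first : ∀ {u v w k x y} (u~v : u ~ v) (u≢w : u ≢ w) (p : Wk v w k x y) → Cut (cons u~v u≢w p) v 0 k
  cut-first u~v u≢w p = cut (nil u~v) p u≢w (λ { (inj₁ eq) → inj₁ eq ; (inj₂ refl) → inj₂ (on-start p) }) inj₂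

  cut-later : ∀ {u v w k x y z i j} (u~v : u ~ v) (u≢w : u ≢ w) (p : Wk v w k x y) →
    Cut p z i j → Cut (cons u~v u≢w p) z (suc i) j
  cut-later u~v u≢w p (cut before after c≢d onˡ onʳ) =
    cut (cons u~v u≢w before) after c≢d (λ { (inj₁ eq) → inj₁ eq ; (inj₂ on) → inj₂ (onˡ on) }) (inj₂ ∘ onʳ)

  cut-at : ∀ {u v k x y} (p : Wk u v k x y) i j → suc (i + j) ≡ k → ∃[ z ] Cut p z i j
  cut-at (cons u~v u≢w p) zero    j refl = _ , cut-first u~v u≢w p
  cut-at (cons u~v u≢w p) (suc i) j refl with cut-at p i j refl
  ... | z , c = z , cut-later u~v u≢w p c

  data Position {u v k x y} (p : Wk u v k x y) (z : V) : Set where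
    start : z ≡ u → Position p z
    end   : z ≡ y → Position p z
    inner : ∀ {i j} → suc (i + j) ≡ k → Cut p z i j → Position p z

  position : ∀ {u v k x y z} (p : Wk u v k x y) → On p z → Position p z
  position (nil _)          (inj₁ eq) = start eq
  position (nil _)          (inj₂ eq) = end eq
  position (cons _ _ _)     (inj₁ eq) = start eq
  position (cons u~v u≢w p) (inj₂ on) with position p on
  ... | start refl = inner refl (cut-first u~v u≢w p)
  ... | end eq     = end eq
  ... | inner eq c = inner (cong suc eq) (cut-later u~v u≢w p c)

  module _ (H : V → Set) where

    open Region H

    -- A common end has the other end as a double repeat. An inner vertex of `p₁` has an opposite
    -- vertex on each of the two cycles that `p₁` forms with `p₂` and `p₃`; these are distinct and
    -- exhaust its repeats.
    theta-saturated : ∀ {u t v₁ v₂ v₃ x₁ x₂ x₃ z}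
      (p₁ : Wk u v₁ (3 + e) x₁ t) (p₂ : Wk u v₂ (3 + e) x₂ t) (p₃ : Wk u v₃ (3 + e) x₃ t) →
      v₁ ≢ v₂ → v₁ ≢ v₃ → v₂ ≢ v₃ →
      (∀ {w} → On p₁ w → H w) → (∀ {w} → On p₂ w → H w) → (∀ {w} → On p₃ w → H w) →
      Position p₁ z → Saturated z
    theta-saturated p₁ p₂ p₃ n₁₂ n₁₃ n₂₃ h₁ h₂ h₃ (start refl) =
      triple⇒saturated p₁ p₂ p₃ ≤-refl ≤-refl ≤-refl n₁₂ n₁₃ n₂₃
        (on⇒inside H p₁ h₁) (on⇒inside H p₂ h₂) (on⇒inside H p₃ h₃)
    theta-saturated p₁ p₂ p₃ n₁₂ n₁₃ n₂₃ h₁ h₂ h₃ (end refl) =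
      triple⇒saturated (rev p₁) (rev p₂) (rev p₃) ≤-refl ≤-refl ≤-refl
        (lasts≢ p₁ p₂ ≤-refl ≤-refl n₁₂) (lasts≢ p₁ p₃ ≤-refl ≤-refl n₁₃) (lasts≢ p₂ p₃ ≤-refl ≤-refl n₂₃)
        (inside-rev p₁ (on⇒inside H p₁ h₁)) (inside-rev p₂ (on⇒inside H p₂ h₂)) (inside-rev p₃ (on⇒inside H p₃ h₃))
    theta-saturated p₁ p₂ p₃ n₁₂ n₁₃ n₂₃ h₁ h₂ h₃ (inner {i} {j} i+j (cut a b c≢d onˡ onʳ)) =
      pairs⇒saturated opposite≢ (opposite p₂ n₁₂ h₂ (proj₂ cut₂)) (opposite p₃ n₁₃ h₃ (proj₂ cut₃))
      where
      j+i : suc (j + i) ≡ 3 + e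
      j+i = trans (cong suc (+-comm j i)) i+j
      cut₂ : ∃[ t ] Cut p₂ t j i
      cut₂ = cut-at p₂ j i j+i
      cut₃ : ∃[ t ] Cut p₃ t j i
      cut₃ = cut-at p₃ j i j+i
      opposite : ∀ {v x s} (p : Wk _ v (3 + e) x _) → _ ≢ v → (∀ {w} → On p w → H w) → Cut p s j i → Pair _ s
      opposite p n h (cut a′ b′ _ onˡ′ onʳ′) = pair
        (join (rev a) n a′) (join b (lasts≢ p₁ p ≤-refl ≤-refl n) (rev b′))
        (≤-reflexive (cong suc i+j)) (≤-reflexive (cong suc j+i)) c≢d
        (inside-join (rev a) n a′ (inside-rev a (on⇒inside H a (h₁ ∘ onˡ))) (on⇒inside H a′ (h ∘ onˡ′)))
        (inside-join b _ (rev b′) (on⇒inside H b (h₁ ∘ onʳ)) (inside-rev b′ (on⇒inside H b′ (h ∘ onʳ′))))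
      j< : j < 3 + e
      j< = ≤-trans (s≤s (m≤n+m j i)) (≤-reflexive i+j)
      opposite≢ : proj₁ cut₂ ≢ proj₁ cut₃
      opposite≢ eq = n₂₃ (proj₂ (short-unique (subst (Wk _ _ j _) eq (Cut.before (proj₂ cut₂))) (Cut.before (proj₂ cut₃)) j< j<))

  first↔last : ∀ {u t v v′ x x′} → Wk u v (3 + e) x t → Wk u v′ (3 + e) x′ t → v ≢ v′ → 1 ≤ B v x′
  first↔last p@(cons u~v u≢w p₀) p′ v≢v′ = around (rev p′) refl
    where
    around : ∀ (r : Wk _ _ (3 + e) _ _) → r ≡ rev p′ → 1 ≤ B _ _
    around (cons _ _ r) _ = two-walks⇒B (cons (~-sym u~v) v≢v′ (rev r))
      (snoc p₀ (lasts≢ p p′ ≤-refl ≤-refl v≢v′) (~-sym (last p′))) ≤-refl ≤-refl u≢w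

  inner-part : ∀ (H : V → Set) {u v k x y} (p : Wk u v (2 + k) x y) → Region.Inside H p →
    ∃[ w ] ∃[ w′ ] ∃ λ (r : Wk v w k w′ x) → Region.Inside H r
  inner-part H (cons _ _ p) (_ , h) with rev p | Region.inside-rev H p h
  ... | cons _ _ r | _ , h′ = _ , _ , rev r , Region.inside-rev H r h′

  no-theta : ∀ {u t v₁ v₂ v₃ x₁ x₂ x₃} →
    Wk u v₁ (3 + e) x₁ t → Wk u v₂ (3 + e) x₂ t → Wk u v₃ (3 + e) x₃ t →
    v₁ ≢ v₂ → v₁ ≢ v₃ → v₂ ≢ v₃ → ⊥
  no-theta {u} {t} {v₁} p₁@(cons {w = w₁} u~v₁ u≢w₁ r₁) p₂ p₃ n₁₂ n₁₃ n₂₃ =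
    from (third-term (a v₁) u w₁ (degree>2 _ _ _)) (inner-part H p₃ (on⇒inside H p₃ (inj₂ ∘ inj₂)))
    where
    H : V → Set
    H z = On p₁ z ⊎ On p₂ z ⊎ On p₃ z

    open Region H

    saturated : ∀ {z} → H z → Saturated z
    saturated (inj₁ on)        = theta-saturated H p₁ p₂ p₃ n₁₂ n₁₃ n₂₃ inj₁ (inj₂ ∘ inj₁) (inj₂ ∘ inj₂) (position p₁ on)
    saturated (inj₂ (inj₁ on)) = theta-saturated H p₂ p₁ p₃ (n₁₂ ∘ ≡sym) n₂₃ n₁₃ (inj₂ ∘ inj₁) inj₁ (inj₂ ∘ inj₂) (position p₂ on)
    saturated (inj₂ (inj₂ on)) = theta-saturated H p₃ p₁ p₂ (n₁₃ ∘ ≡sym) (n₂₃ ∘ ≡sym) n₁₂ (inj₂ ∘ inj₂) inj₁ (inj₂ ∘ inj₁) (position p₃ on)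

    module _ {y : V} (v₁~y : v₁ ~ y) (u≢y : u ≢ y) (w₁≢y : w₁ ≢ y) where

      u→y : Wk u v₁ 1 v₁ y
      u→y = cons u~v₁ u≢y (nil v₁~y)

      -- y is at distance 2 from u, through v₁.
      meets : ∀ {v x} {p : Wk u v (3 + e) x t} → Position p y →
        v₁ ≡ v × ∃[ j ] j ≡ 1 + e × ∃[ d ] v₁ ≢ d × Wk y d j x t
      meets (start y≡u)  = contradiction (≡sym y≡u) u≢y
      meets {p = p} (end refl) with () ← proj₁ (long-unique u→y p (s≤s (s≤s z≤n)) ≤-refl)
      meets (inner {i} {j} i+j (cut before after c≢d _ _)) with long-unique u→y before (s≤s (s≤s z≤n))
          (≤-trans (s≤s (m≤m+n i j)) (≤-trans (≤-reflexive i+j) (n≤1+n _)))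
      meets (inner {i} {j} i+j (cut (cons _ _ (nil _)) after c≢d _ _)) | refl , refl =
        refl , j , suc-injective (suc-injective i+j) , _ , c≢d , after

      y∉H : ¬ H y
      y∉H (inj₂ (inj₁ on)) = n₁₂ (proj₁ (meets (position p₂ on)))
      y∉H (inj₂ (inj₂ on)) = n₁₃ (proj₁ (meets (position p₃ on)))
      y∉H (inj₁ on) with meets (position p₁ on)
      ... | _ , _ , refl , d , v₁≢d , p = w₁≢y (proj₂ (short-unique r₁ (cons v₁~y v₁≢d p) ≤-refl ≤-refl))

    from : ∃[ y ] u ≢ y × w₁ ≢ y × 1 ≤ a v₁ y →
      ∃[ w ] ∃[ w′ ] ∃ (λ (r : Wk _ w (1 + e) w′ _) → Inside r) → ⊥
    from (y , u≢y , w₁≢y , v₁~y) (_ , _ , r , r∈H) =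
      -- In the notation of `impossible`, x₀ is `v₁`, x₁ and x₋₁ are the last vertices before `t` on
      -- `p₂` and `p₃`, and x₂ is `v₃`. The hubs are `t` and `u`.
      impossible saturated (inj₁ (inj₂ (on-start r₁))) (first↔last p₁ p₂ n₁₂) (first↔last p₁ p₃ n₁₃)
        (B-flip (first↔last p₃ p₂ (n₂₃ ∘ ≡sym)))
        (hub (inj₁ (on-end p₁)) (~-sym (last p₃)) (inj₂ (~-sym (last p₂) , lasts≢ p₂ p₃ ≤-refl ≤-refl n₂₃)))
        (hub (inj₁ (on-start p₁)) (first p₃) (inj₂ (u~v₁ , n₁₃)))
        r r∈H (a⇒~ v₁~y) (y∉H (a⇒~ v₁~y) u≢y w₁≢y)

  B≤1 : ∀ u t → B u t ≤ 1
  B≤1 u t = ≮⇒≥ λ 2≤B → three 2≤B (other-walk (≤-trans (s≤s z≤n) 2≤B) u)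
    where
    three : 2 ≤ B u t → Other u t u → ⊥
    three 2≤B (v₁ , _ , _ , i< , _ , p₁) with other-walk (≤-trans (s≤s z≤n) 2≤B) v₁
    ... | v₂ , n₁₂ , _ , j< , _ , p₂ with third-walk 2≤B v₁ v₂
    ... | v₃ , n₁₃ , n₂₃ , _ , k< , _ , p₃
      with B⇒even (≤-trans (s≤s z≤n) 2≤B) p₁ i< | B⇒even (≤-trans (s≤s z≤n) 2≤B) p₂ j< | B⇒even (≤-trans (s≤s z≤n) 2≤B) p₃ k<
    ... | refl | refl | refl = no-theta p₁ p₂ p₃ n₁₂ n₁₃ n₂₃

  -- Cycles of length 2D

  R : ℕ
  R = 3 + e + D

  N : ℕ
  N = suc R

  decompose : ∀ i → ∃[ j ] ∃[ k ] j < N × i ≡ j + k * N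
  decompose i = i % N , i / N , m%n<n i N , m≡m%n+[m/n]*n i N

  -- The cycle is traversed backwards, as R ≡ −1 modulo N.
  flip : Cycle N → Cycle N
  flip C .at i = at C (i * R)
  flip C .adjacent i = ~-sym (subst (at C (R + i * R) ~_)
    (trans (cong (at C) (+-comm N (i * R))) (periodic C (i * R))) (adjacent C (R + i * R)))
  flip C .turning i eq = turning C (R + (R + i * R)) (trans (≡sym eq) (≡sym (trans (cong (at C) (begin
      2 + (R + (R + i * R))   ≡⟨ cong suc (+-suc R (R + i * R)) ⟨
      N + (N + i * R)         ≡⟨ +-comm N (N + i * R) ⟩
      N + i * R + N           ≡⟨ cong (_+ N) (+-comm N (i * R)) ⟩
      i * R + N + N           ∎)) (trans (periodic C (i * R + N)) (periodic C (i * R))))))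
    where open ≡-Reasoning
  flip C .periodic i = trans (cong (at C) (trans (*-distribʳ-+ R i N) (cong (i * R +_) (*-comm N R)))) (periodic* C (i * R) R)

  flip-1 : ∀ C → at (flip C) 1 ≡ at C R
  flip-1 C = cong (at C) (+-identityʳ R)

  flip-R : ∀ C → at (flip C) R ≡ at C 1
  flip-R C = trans (cong (at C) (cong suc (≡sym (*-suc R′ R)))) (periodic* C 1 R′)
    where
    R′ : ℕ
    R′ = 2 + e + D

  -- D steps backwards lead to the same vertex as D steps forwards, since `D * R` is congruent to
  -- `D` modulo `N`.
  flip-opposite : ∀ C i → at (flip C) (D + i) ≡ at C (D + i * R)
  flip-opposite C i = trans (cong (at C) eq) (periodic* C (D + i * R) (3 + e))
    where
    open ≡-Reasoning
    g : ℕ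
    g = 3 + e
    D*R : D * R ≡ D + g * N
    D*R = begin
      g + D + g * R       ≡⟨ cong (_+ g * R) (+-comm g D) ⟩
      D + g + g * R       ≡⟨ +-assoc D g (g * R) ⟩
      D + (g + g * R)     ≡⟨ cong (D +_) (*-suc g R) ⟨
      D + g * N           ∎
    eq : (D + i) * R ≡ D + i * R + g * N
    eq = begin
      (D + i) * R           ≡⟨ *-distribʳ-+ R D i ⟩
      D * R + i * R         ≡⟨ cong (_+ i * R) D*R ⟩
      D + g * N + i * R     ≡⟨ +-assoc D (g * N) (i * R) ⟩
      D + (g * N + i * R)   ≡⟨ cong (D +_) (+-comm (g * N) (i * R)) ⟩
      D + (i * R + g * N)   ≡⟨ +-assoc D (i * R) (g * N) ⟨
      D + i * R + g * N     ∎

  tail : ∀ {m} → Cycle m → Cycle m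
  tail C .at i       = at C (suc i)
  tail C .adjacent i = adjacent C (suc i)
  tail C .turning i  = turning C (suc i)
  tail C .periodic i = periodic C (suc i)

  backward : (C : Cycle N) → Wk (at C 0) (at C R) (3 + e) (at C (1 + D)) (at C D)
  backward C = subst (λ z → Wk z (at C R) (3 + e) (at C (1 + D)) (at C D)) (periodic C 0)
    (rev (segment (shift D C) (3 + e)))

  ends≢ : (C : Cycle N) → at C 1 ≢ at C R
  ends≢ C eq = turning C R (trans (≡sym eq) (≡sym (periodic C 1)))

  opposite : (C : Cycle N) → 1 ≤ B (at C 0) (at C D)
  opposite C = two-walks⇒B (segment C (3 + e)) (backward C) ≤-refl ≤-refl (ends≢ C)

  segment-agree : ∀ {m} (C C′ : Cycle m) k → k ≤ 3 + e → at C 0 ≡ at C′ 0 → at C k ≡ at C′ k →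
    ∀ {i} → i ≤ k → at C i ≡ at C′ i
  segment-agree C C′ k       k≤ eq₀ eqₖ {zero}  _         = eq₀
  segment-agree C C′ (suc k) k≤ eq₀ eqₖ {suc i} (s≤s i≤k) =
    segment-agree (tail C) (tail C′) k (≤-trans (n≤1+n k) k≤) eq₁ eqₖ i≤k
    where
    eq₁ : at C 1 ≡ at C′ 1
    eq₁ = proj₂ (short-unique (segment C k)
      (subst₂ (λ s t → Wk s (at C′ 1) k (at C′ k) t) (≡sym eq₀) (≡sym eqₖ) (segment C′ k)) k≤ k≤)

  agree : (C C′ : Cycle N) → at C 0 ≡ at C′ 0 → at C D ≡ at C′ D → at C 1 ≡ at C′ 1 → at C R ≡ at C′ R →
    ∀ i → at C i ≡ at C′ i
  agree C C′ eq₀ eq-D eq₁ eq-R i with decompose i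
  ... | j , k , j<N , refl = trans (periodic* C j k) (trans (below j<N) (≡sym (periodic* C′ j k)))
    where
    below : ∀ {j} → j < N → at C j ≡ at C′ j
    below {zero}  _ = eq₀
    below {suc j} j< with suc j ≤? D
    ... | yes j≤ = segment-agree (tail C) (tail C′) (3 + e) ≤-refl eq₁ eq-D (s≤s⁻¹ j≤)
    ... | no j≰ with ≤⇒∃+ (≰⇒≥ j≰)
    ...   | o , o+D = subst (λ i → at C i ≡ at C′ i) o+D
              (segment-agree (shift D C) (shift D C′) (3 + e) ≤-refl eq-D eq-R
                (+-cancelʳ-≤ D o (3 + e) (≤-trans (≤-reflexive o+D) (s≤s⁻¹ j<))))

  infix 4 _⊑_
  -- Rotation and direction are left open; the partition only needs that every ordered opposite pair
  -- of one cycle is one of the other.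
  _⊑_ : Cycle N → Cycle N → Set
  G ⊑ C = ∀ i → ∃[ j ] at G i ≡ at C j × at G (D + i) ≡ at C (D + j)

  -- The two walks of length D between opposite vertices are determined by these
  -- vertices, so the cycle is determined up to its direction.
  opposite-determines : (C C′ : Cycle N) → at C 0 ≡ at C′ 0 → at C D ≡ at C′ D → C′ ⊑ C
  opposite-determines C C′ eq₀ eq-D with at C′ 1 ≟F at C 1 | at C′ 1 ≟F at C R
  ... | yes eq₁ | _ = λ i → i , ≡sym (all i) , ≡sym (all (D + i))
    where
    eq-R : at C R ≡ at C′ R
    eq-R with at C R ≟F at C′ R
    ... | yes eq = eq
    ... | no neq = contradiction (three-walks⇒B (segment C (3 + e)) (backward C)
            (subst₂ (λ s t → Wk s (at C′ R) (3 + e) (at C′ (1 + D)) t) (≡sym eq₀) (≡sym eq-D) (backward C′))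
            ≤-refl ≤-refl ≤-refl (ends≢ C) (λ eq → ends≢ C′ (trans eq₁ eq)) neq) (<⇒≱ (s≤s (B≤1 _ _)))
    all : ∀ i → at C i ≡ at C′ i
    all = agree C C′ eq₀ eq-D (≡sym eq₁) eq-R
  ... | no _ | yes eq₁ = λ i → i * R , ≡sym (all i) , trans (≡sym (all (D + i))) (flip-opposite C i)
    where
    eq-R : at C 1 ≡ at C′ R
    eq-R with at C 1 ≟F at C′ R
    ... | yes eq = eq
    ... | no neq = contradiction (three-walks⇒B (segment C (3 + e)) (backward C)
            (subst₂ (λ s t → Wk s (at C′ R) (3 + e) (at C′ (1 + D)) t) (≡sym eq₀) (≡sym eq-D) (backward C′))
            ≤-refl ≤-refl ≤-refl (ends≢ C) neq (λ eq → ends≢ C′ (trans eq₁ eq))) (<⇒≱ (s≤s (B≤1 _ _)))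
    all : ∀ i → at (flip C) i ≡ at C′ i
    all = agree (flip C) C′ eq₀
      (trans (cong (at (flip C)) (≡sym (+-identityʳ D))) (trans (flip-opposite C 0) (trans (cong (at C) (+-identityʳ D)) eq-D)))
      (trans (flip-1 C) (≡sym eq₁)) (trans (flip-R C) eq-R)
  ... | no n₁ | no n₂ = contradiction (three-walks⇒B (segment C (3 + e)) (backward C)
            (subst₂ (λ s t → Wk s (at C′ 1) (3 + e) (at C′ (3 + e)) t) (≡sym eq₀) (≡sym eq-D) (segment C′ (3 + e)))
            ≤-refl ≤-refl ≤-refl (ends≢ C) (n₁ ∘ ≡sym) (n₂ ∘ ≡sym)) (<⇒≱ (s≤s (B≤1 _ _)))

  -- A coincidence splits the closed walk into two closed arcs, one of which has length at most D.
  injective : (C : Cycle N) → ∀ {i j} → i < j → j < N → at C i ≢ at C j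
  injective C {i} {j} i<j j<N eq with ≤⇒∃+ i<j
  ... | o , refl with o <? D
  ...   | yes o<D = no-loop (subst (Wk _ _ o _) (trans (cong (at C) (≡sym (+-suc o i))) (≡sym eq)) (segment (shift i C) o)) o<D
  ...   | no o≮D with ≤⇒∃+ j<N
  ...     | r , r+j = no-loop (subst (Wk _ _ (r + i) _) closes (segment (shift (o + suc i) C) (r + i))) r+i<D
    where
    open ≡-Reasoning
    j′ : ℕ
    j′ = o + suc i
    closes : at C (suc (r + i) + j′) ≡ at C j′
    closes = trans (cong (at C) (begin
      suc (r + i + j′)     ≡⟨ cong (λ x → suc (x + j′)) (+-comm r i) ⟩
      suc (i + r + j′)     ≡⟨ cong suc (+-assoc i r j′) ⟩
      suc (i + (r + j′))   ≡⟨ +-suc i (r + j′) ⟨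
      i + suc (r + j′)     ≡⟨ cong (i +_) (trans (≡sym (+-suc r j′)) r+j) ⟩
      i + N                ∎)) (trans (periodic C i) eq)
    r+i<D : r + i < D
    r+i<D = s≤s (m≤n⇒m≤1+n (+-cancelʳ-≤ (2 + D) (r + i) (2 + e) bound))
      where
      bound : r + i + (2 + D) ≤ 2 + e + (2 + D)
      bound = ≤-trans (+-monoʳ-≤ (r + i) (s≤s (s≤s (≮⇒≥ o≮D)))) (≤-reflexive (begin
        r + i + (2 + o)        ≡⟨ +-assoc r i (2 + o) ⟩
        r + (i + (2 + o))      ≡⟨ cong (r +_) (+-comm i (2 + o)) ⟩
        r + (2 + (o + i))      ≡⟨ cong (λ x → r + suc x) (+-suc o i) ⟨
        r + suc j′             ≡⟨ r+j ⟩
        N                      ≡⟨ cong (2 +_) (trans (cong suc (≡sym (+-suc e D))) (≡sym (+-suc e (suc D)))) ⟩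
        2 + e + (2 + D)        ∎))

  -- The partition of the repeats into classes of size 2D

  oppositePair : Cycle N → ℕ → V × V
  oppositePair C i = at C i , at C (D + i)

  oppositePairs : Cycle N → List (V × V)
  oppositePairs C = applyUpTo (oppositePair C) N

  ∈-oppositePairs : ∀ C i → oppositePair C i ∈ oppositePairs C
  ∈-oppositePairs C i with decompose i
  ... | j , k , j<N , refl = subst (_∈ oppositePairs C) (≡sym (cong₂ _,_ (periodic* C j k)
    (trans (cong (at C) (≡sym (+-assoc D j (k * N)))) (periodic* C (D + j) k)))) (∈-applyUpTo⁺ (oppositePair C) j<N)

  record Through (m : ℕ) (x : V × V) : Set where
    constructor through
    field
      cycle  : Cycle m
      begins : at cycle 0 ≡ proj₁ x
      passes : at cycle D ≡ proj₂ x

  open Through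

  Class : V × V → List (V × V) → Set
  Class x c = ∃ λ (τ : Through N x) → c ≡ oppositePairs (cycle τ)

  ends : ∀ {x} (τ : Through N x) i → i ≡ 0 → oppositePair (cycle τ) i ≡ x
  ends τ _ refl = cong₂ _,_ (begins τ) (trans (cong (at (cycle τ)) (+-identityʳ D)) (passes τ))

  class-properties : ∀ {x c} → Class x c → length c ≡ N × Unique c × x ∈ c
  class-properties (τ , refl) = length-applyUpTo (oppositePair C) N
    , applyUpTo⁺₁ (oppositePair C) N (λ i<j j<N eq → injective C i<j j<N (cong proj₁ eq))
    , subst (_∈ oppositePairs C) (ends τ 0 refl) (∈-oppositePairs C 0)
    where
    C : Cycle N
    C = cycle τ

  classes-meet : ∀ {x c z c′ w} → Class x c → Class z c′ → w ∈ c → w ∈ c′ → z ∈ c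
  classes-meet (τ , refl) (τ′ , refl) w∈c w∈c′ =
    meet (∈-applyUpTo⁻ (oppositePair C) w∈c) (∈-applyUpTo⁻ (oppositePair C′) w∈c′)
    where
    open ≡-Reasoning
    C C′ : Cycle N
    C  = cycle τ
    C′ = cycle τ′
    -- Both cycles are started at w, and the start of C′ is reached after m steps.
    meet : ∀ {w} → ∃[ i ] i < N × w ≡ oppositePair C i → ∃[ j ] j < N × w ≡ oppositePair C′ j → _ ∈ oppositePairs C
    meet (i , _ , refl) (j , j<N , eq) =
      subst (_∈ oppositePairs C) (trans (≡sym same) reached) (∈-oppositePairs C (proj₁ found + i))
      where
      m : ℕ
      m = N ∸ j
      m+j≡N : m + j ≡ N
      m+j≡N = m∸n+n≡m (<⇒≤ j<N)
      found : ∃[ l ] at (shift j C′) m ≡ at (shift i C) l × at (shift j C′) (D + m) ≡ at (shift i C) (D + l)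
      found = opposite-determines (shift i C) (shift j C′) (cong proj₁ eq) (cong proj₂ eq) m
      same : oppositePair C′ (m + j) ≡ oppositePair C (proj₁ found + i)
      same = cong₂ _,_ (proj₁ (proj₂ found)) (trans (cong (at C′) (≡sym (+-assoc D m j)))
        (trans (proj₂ (proj₂ found)) (cong (at C) (+-assoc D (proj₁ found) i))))
      reached : oppositePair C′ (m + j) ≡ _
      reached = cong₂ _,_
        (trans (cong (at C′) m+j≡N) (trans (periodic C′ 0) (begins τ′)))
        (trans (cong (at C′ ∘ (D +_)) m+j≡N) (trans (periodic C′ D) (passes τ′)))

  repeat⇒through : ∀ {u t} → 1 ≤ B u t → Through N (u , t)
  repeat⇒through {u} {t} b = by-parity (repeat b)
    where
    by-parity : Repeat u t → Through N (u , t)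
    by-parity (odd v≢v′ p p′) = ⊥-elim (no-odd-repeat v≢v′ p p′)
    by-parity (even v≢v′ p p′) = subst (λ m → Through m (u , t)) (cong suc (≡sym (+-suc (3 + e) (3 + e))))
      (through (closed⇒cycle closedWalk) refl
        (trans (unroll-vertex closedWalk D≤) (trans (vertex-snoc half _ _ D≤) (vertex-join p _ (rev p′)))))
      where
      half : Wk u _ (suc (3 + e + (3 + e))) _ u
      half = join p (lasts≢ p p′ ≤-refl ≤-refl v≢v′) (rev p′)
      closedWalk : Wk u _ (2 + (3 + e + (3 + e))) u _
      closedWalk = snoc half (v≢v′ ∘ ≡sym) (first p)
      D≤ : D ≤ 2 + (3 + e + (3 + e))
      D≤ = m≤n⇒m≤1+n (s≤s (m≤m+n (3 + e) (3 + e)))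

  Repeated? : Decidable (λ (x : V × V) → 1 ≤ B (proj₁ x) (proj₂ x))
  Repeated? x = 1 ≤? B (proj₁ x) (proj₂ x)

  repeats : List (V × V)
  repeats = filter Repeated? (cartesianProduct (allFin n) (allFin n))

  ∈-repeats : ∀ {u t} → 1 ≤ B u t → (u , t) ∈ repeats
  ∈-repeats {u} {t} b = ∈-filter⁺ Repeated? (∈-cartesianProduct⁺ (∈-allFin u) (∈-allFin t)) b

  length-repeats : length repeats ≡ n * 2
  length-repeats = trans (length-filter-product Repeated? (allFin n) (allFin n) 2 row)
    (cong (_* 2) {length (allFin n)} {n} (length-tabulate id))
    where
    row : ∀ u → length (filter (Repeated? ∘ (u ,_)) (allFin n)) ≡ 2
    row u = trans (length-filter-∑ (B u) id (B≤1 u)) (rowB u)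

  oppositePair∈repeats : ∀ C {w} → ∃[ i ] i < N × w ≡ oppositePair C i → w ∈ repeats
  oppositePair∈repeats C (i , _ , refl) = ∈-repeats (opposite (shift i C))

  classOf : ∀ {x} → x ∈ repeats → ∃[ c ] Class x c × (∀ {w} → w ∈ c → w ∈ repeats)
  classOf {x} x∈ = oppositePairs (cycle τ) , (τ , refl) ,
    λ w∈ → oppositePair∈repeats (cycle τ) (∈-applyUpTo⁻ (oppositePair (cycle τ)) w∈)
    where
    τ : Through N x
    τ = repeat⇒through (proj₂ (∈-filter⁻ Repeated? {xs = cartesianProduct (allFin n) (allFin n)} x∈))

  2D∣repeats : N ∣ length repeats
  2D∣repeats = partition⇒∣ (≡-dec _≟F_ _≟F_) N Class class-properties classes-meet (length repeats) repeats ≤-refl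
      (filter⁺ Repeated? (cartesianProduct⁺ (allFin⁺ n) (allFin⁺ n))) classOf

  D∣n : D ∣ n
  D∣n = *-cancelʳ-∣ {D} {n} 2 (subst₂ _∣_ N≡ length-repeats 2D∣repeats)
    where
    N≡ : N ≡ D * 2
    N≡ = trans (cong (D +_) (≡sym (+-identityʳ D))) (*-comm 2 D)

-- Regularity from the order, and the theorem

module Existence {n : ℕ} (Γ : Graph n) (q e : ℕ) (4≤q : 4 ≤ q)
  (maxDegree : ∀ v → degree Γ v ≤ suc q) (distances : ∀ u v → DistLe Γ u v (4 + e))
  (order : n + 2 ≡ 1 + suc q * geomSum q (4 + e)) where

  open Walks Γ

  bound : ∀ v → ∑ (a v) ≤ suc q
  bound v = subst (_≤ suc q) (degree-∑ v) (maxDegree v)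

  connected : ∀ u t → 1 ≤ S (4 + e) u t
  connected u t with distances u t
  ... | j , j≤D , p with Walk⇒F p
  ... | i , i≤j , f = ≤-trans f (F≤S (≤-trans i≤j j≤D) u t)

  g : ℕ
  g = geomSum q (4 + e)

  -- Each missing edge at a vertex costs `g` walks, and the order leaves room for only 2.
  3≤g : 3 ≤ g
  3≤g = +-mono-≤ (power (3 + e)) (+-mono-≤ (power (2 + e)) (≤-trans (power (1 + e)) (m≤m+n _ _)))
    where
    power : ∀ k → 1 ≤ q ^ k
    power k = m^n>0 q {{>-nonZero (≤-trans (s≤s z≤n) 4≤q)}} k

  -- A vertex of smaller degree would reach at most 1 + q g vertices.
  regular : ∀ v → ∑ (a v) ≡ suc q
  regular v = ≤-antisym (bound v) (≮⇒≥ λ small → <⇒≱ 3≤g (+-cancelʳ-≤ (q * g) g 2 (s≤s⁻¹ (begin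
      1 + suc q * g            ≡⟨ order ⟨
      n + 2                    ≤⟨ +-monoˡ-≤ 2 (≤-trans n≤S (≤-trans (rowS (4 + e) v) (s≤s (*-monoˡ-≤ g (s≤s⁻¹ small))))) ⟩
      1 + q * g + 2            ≡⟨ cong suc (+-comm (q * g) 2) ⟩
      1 + (2 + q * g)          ∎))))
    where
    open ≤-Reasoning
    open Bounded q bound
    n≤S : n ≤ ∑ (S (4 + e) v)
    n≤S = subst (_≤ ∑ (S (4 + e) v)) (trans (∑-const {n} 1) (*-identityʳ n)) (∑-mono {n} (connected v))

  divides-order : 4 + e ∣ n
  divides-order = Defect.D∣n Γ q e 4≤q regular connected order

theorem5p9 : (d D : ℕ) → 5 ≤ d → ¬ (2 ∣ d) → 4 ≤ D →
    ¬ (D ∣ (d * geomSum (d ∸ 1) D ∸ 1)) →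
    (n : ℕ) → (G : Graph n) → ¬ IsDDEGraph d D 2 G
theorem5p9 (suc q) _ (s≤s 4≤q) _ (s≤s (s≤s (s≤s (s≤s {n = e} _)))) D∤n n G ((maxDegree , _) , (distances , _) , n≡) =
  D∤n (subst (4 + e ∣_) n≡ (Existence.divides-order G q e 4≤q maxDegree distances order))
  where
  m : ℕ
  m = suc q * geomSum q (4 + e)
  1≤m : 1 ≤ m
  1≤m = *-mono-≤ (s≤s (z≤n {q})) (≤-trans (m^n>0 q {{>-nonZero (≤-trans (s≤s z≤n) 4≤q)}} (3 + e)) (m≤m+n _ _))
  order : n + 2 ≡ 1 + m
  order = begin
    n + 2             ≡⟨ cong (_+ 2) n≡ ⟩
    m ∸ 1 + 2         ≡⟨ +-suc (m ∸ 1) 1 ⟩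
    suc (m ∸ 1 + 1)   ≡⟨ cong suc (m∸n+n≡m 1≤m) ⟩
    1 + m             ∎
    where open ≡-Reasoning
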